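{- Let $G$ be a finite simple graph with maximum degree $\Delta(G)$ that satisfies Property A, i.e. every induced subgraph $H$ of $G$ (with at least one vertex) satisfies $|E(H)| \le 2|V(H)| - 1$. Then $a'(G) \le \Delta(G) + 3$.
   Context: A proper edge coloring of a graph assigns colors to edges so that adjacent edges receive different colors. An acyclic edge coloring is a proper edge coloring with no bichromatic cycle, i.e. no cycle whose edges use only two colors. The acyclic chromatic index $a'(G)$ is the minimum number of colors in an acyclic edge coloring of $G$. $\Delta(G)$ denotes the maximum degree of $G$. -}

module Defs where

open import Data.Nat using (ℕ; zero; suc; _+_; _*_; _≤_; _<_; _⊔_)
open import Data.Bool using (Bool; true; false; T; if_then_else_; _∧_)
open import Data.Fin using (Fin; zero; suc; toℕ; inject₁; fromℕ)
open import Data.Product using (Σ; _×_; _,_; ∃)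
open import Data.Sum using (_⊎_)
open import Function.Definitions using (Injective)
open import Relation.Binary.PropositionalEquality using (_≡_; _≢_)
open import Relation.Nullary using (¬_; does)
open import Data.Nat.Properties using (_<?_)

record Graph (n : ℕ) : Set where
  field
    adj     : Fin n → Fin n → Bool
    sym     : ∀ u v → adj u v ≡ adj v u
    irrefl  : ∀ v → adj v v ≡ false
open Graph public

Adj : ∀ {n} → Graph n → Fin n → Fin n → Set
Adj G u v = T (adj G u v)

count : ∀ {n} → (Fin n → Bool) → ℕ
count {zero}  p = 0
count {suc n} p = (if p zero then 1 else 0) + count (λ i → p (suc i))

maxF : ∀ {n} → (Fin n → ℕ) → ℕ
maxF {zero}  f = 0
maxF {suc n} f = f zero ⊔ maxF (λ i → f (suc i))

degree : ∀ {n} → Graph n → Fin n → ℕ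
degree G u = count (adj G u)

maxDegree : ∀ {n} → Graph n → ℕ
maxDegree G = maxF (degree G)

VSet : ℕ → Set
VSet n = Fin n → Bool

size : ∀ {n} → VSet n → ℕ
size S = count S

sumF : ∀ {n} → (Fin n → ℕ) → ℕ
sumF {zero}  f = 0
sumF {suc n} f = f zero + sumF (λ i → f (suc i))

inducedEdges : ∀ {n} → Graph n → VSet n → ℕ
inducedEdges G S =
  sumF (λ u → count (λ v → S u ∧ S v ∧ adj G u v ∧ does (toℕ u <? toℕ v)))

-- Property A: every induced subgraph H with |V(H)| ≥ 1 has |E(H)| ≤ 2|V(H)| - 1
-- (stated as |E(H)| + 1 ≤ 2|V(H)|, equivalent under |V(H)| ≥ 1 in ℕ)
PropertyA : ∀ {n} → Graph n → Set
PropertyA {n} G = (S : VSet n) → 1 ≤ size S → inducedEdges G S + 1 ≤ 2 * size S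

-- an edge colouring with k colours: a colour for every ordered pair,
-- required to be symmetric on edges (so it is a colouring of unordered edges);
-- values on non-edges are irrelevant
record EdgeColouring {n} (G : Graph n) (k : ℕ) : Set where
  field
    col    : Fin n → Fin n → Fin k
    colSym : ∀ u v → Adj G u v → col u v ≡ col v u
open EdgeColouring public

Proper : ∀ {n k} {G : Graph n} → EdgeColouring G k → Set
Proper {n} {k} {G} c =
  ∀ u v w → Adj G u v → Adj G u w → v ≢ w → col c u v ≢ col c u w

-- a cycle of length suc j ≥ 3 in G: distinct vertices f 0, …, f j with
-- f i ~ f (i+1) for i < j and f j ~ f 0
record Cycle {n} (G : Graph n) : Set where
  field
    j      : ℕ
    len≥3  : 2 ≤ j
    vert   : Fin (suc j) → Fin n
    inj    : Injective _≡_ _≡_ vert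
    step   : (i : Fin j) → Adj G (vert (inject₁ i)) (vert (suc i))
    close  : Adj G (vert (fromℕ j)) (vert zero)
open Cycle public

Bichromatic : ∀ {n k} {G : Graph n} → EdgeColouring G k → Cycle G → Set
Bichromatic {n} {k} c C = Σ (Fin k) λ a → Σ (Fin k) λ b →
  ((i : Fin (j C)) → InAB a b (col c (vert C (inject₁ i)) (vert C (suc i))))
  × InAB a b (col c (vert C (fromℕ (j C))) (vert C zero))
  where
    InAB : Fin k → Fin k → Fin k → Set
    InAB a b x = (x ≡ a) ⊎ (x ≡ b)

Acyclic : ∀ {n k} {G : Graph n} → EdgeColouring G k → Set
Acyclic {n} {k} {G} c = Proper c × ((C : Cycle G) → ¬ Bichromatic c C)

-- G has an acyclic edge colouring with k colours (i.e. a'(G) ≤ k)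
HasAcyclicEdgeColouring : ∀ {n} → Graph n → ℕ → Set
HasAcyclicEdgeColouring G k = Σ (EdgeColouring G k) Acyclic

{-# OPTIONS --safe #-}
module Submission where

-- Fix K = Δ + 3 colours and let g be a subgraph of G that cannot be coloured although g minus any
-- edge can. Call x small if deg x ≤ 2 and cubic if deg x = 3. Three configurations cannot occur in g:
--   * a small x adjacent to a q with at most three neighbours of degree ≥ 5;
--   * a cubic x adjacent to a q of degree ≤ 4;
--   * a q of degree 5 with at least four cubic neighbours.
-- On the other hand they are unavoidable: in the graph induced on the vertices of degree ≥ 3 give every
-- vertex the charge (degree − 4) and let every cubic vertex take 1/3 from each of its neighbours. If none
-- of the configurations occurs, no charge ends up negative, so this graph has at least 2|V| edges,
-- against Property A.
--
-- For the reducibility of a configuration, uncolour all edges at x. Writing Y, Z, N for the colours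
-- missing at the neighbours y, z, q of x, three distinct colours from Y, Z and N extend the colouring
-- unless two of them are joined by an alternating path between the corresponding neighbours, and for two
-- given colours at most one pair of the three neighbours can be joined. That g cannot be coloured is
-- assumed throughout, so that case distinctions on paths are classical; at the end, the existence of
-- a colouring is decidable by exhaustive search.

open import Defs hiding (sym; step)
open import Data.Bool using (Bool; true; false; T; if_then_else_; _∧_; _∨_; not)
open import Data.Bool.Properties using (∧-identityʳ; ∧-zeroʳ; ∧-comm; ∨-comm; T-≡; T?)
open import Data.Empty using (⊥; ⊥-elim)
open import Data.Fin using (Fin; zero; suc; toℕ; inject₁; fromℕ; fromℕ<) renaming (_≟_ to _≟F_)
open import Data.Fin.Properties using (toℕ-injective; ¬∀⟶∃¬; any?; all?; injective⇒≤)
open import Data.List using (List; []; _∷_; _++_; length)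
open import Data.List.Membership.Propositional using (_∈_; _∉_)
open import Data.List.Membership.Propositional.Properties using (∈-++⁺ˡ; ∈-++⁺ʳ)
open import Data.List.Properties using (length-++)
open import Data.List.Relation.Unary.Any using (here; there)
open import Data.Maybe using (Maybe; just; nothing; is-just; fromMaybe)
open import Data.Maybe.Properties using (just-injective)
open import Data.Nat using (ℕ; zero; suc; _+_; _*_; _≤_; _<_; _≤?_; _<?_; _≟_; z≤n; s≤s)
open import Data.Nat.Induction using (<-wellFounded)
open import Data.Nat.Properties
open import Data.Nat.Tactic.RingSolver using (solve-∀)
open import Data.Product using (_×_; _,_; proj₁; proj₂; ∃)
open import Data.Sum as Sum using (_⊎_; inj₁; inj₂)
open import Data.Vec using (Vec; []; _∷_; lookup; tabulate)
open import Data.Vec.Properties using (lookup∘tabulate)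
open import Function using (_∘_; Equivalence)
open import Induction.WellFounded using (Acc; acc)
open import Relation.Binary.Definitions using (tri<; tri≈; tri>)
open import Relation.Binary.PropositionalEquality
open import Relation.Nullary using (¬_; Dec; yes; no; does; ¬?; _×-dec_; _⊎-dec_; _→-dec_)
open import Relation.Nullary.Decidable using (dec-true; dec-false; decidable-stable; map′)
open import Relation.Unary using (Decidable)

-- Booleans, finite sums and counting

witness : ∀ {P : Set} (d : Dec P) → does d ≡ true → P
witness (yes p) _ = p

refutation : ∀ {P : Set} (d : Dec P) → not (does d) ≡ true → ¬ P
refutation (no ¬p) _ = ¬p

clash : false ≡ true → ⊥
clash ()

∧-elim : ∀ {a b} → a ∧ b ≡ true → a ≡ true × b ≡ true
∧-elim {true} {true} _ = refl , refl

∧-intro : ∀ {a b} → a ≡ true → b ≡ true → a ∧ b ≡ true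
∧-intro refl refl = refl

χ : Bool → ℕ
χ b = if b then 1 else 0

χ-mono : ∀ {a b} → (a ≡ true → b ≡ true) → χ a ≤ χ b
χ-mono {false} h = z≤n
χ-mono {true} h rewrite h refl = ≤-refl

sumF-mono : ∀ {n} {f g : Fin n → ℕ} → (∀ i → f i ≤ g i) → sumF f ≤ sumF g
sumF-mono {zero} h = z≤n
sumF-mono {suc n} h = +-mono-≤ (h zero) (sumF-mono (h ∘ suc))

sumF-cong : ∀ {n} {f g : Fin n → ℕ} → (∀ i → f i ≡ g i) → sumF f ≡ sumF g
sumF-cong {zero} h = refl
sumF-cong {suc n} h = cong₂ _+_ (h zero) (sumF-cong (h ∘ suc))

sumF-mono-< : ∀ {n} {f g : Fin n → ℕ} → (∀ i → f i ≤ g i) → ∀ j → f j < g j → sumF f < sumF g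
sumF-mono-< h zero lt = +-mono-<-≤ lt (sumF-mono (h ∘ suc))
sumF-mono-< h (suc j) lt = +-mono-≤-< (h zero) (sumF-mono-< (h ∘ suc) j lt)

+-interchange : ∀ a b c d → (a + b) + (c + d) ≡ (a + c) + (b + d)
+-interchange = solve-∀

sumF-+ : ∀ {n} (f g : Fin n → ℕ) → sumF (λ i → f i + g i) ≡ sumF f + sumF g
sumF-+ {zero} f g = refl
sumF-+ {suc n} f g rewrite sumF-+ (f ∘ suc) (g ∘ suc) =
  +-interchange (f zero) (g zero) (sumF (f ∘ suc)) (sumF (g ∘ suc))

sumF-* : ∀ {n} k (f : Fin n → ℕ) → sumF (λ i → k * f i) ≡ k * sumF f
sumF-* {zero} k f = sym (*-zeroʳ k)
sumF-* {suc n} k f rewrite sumF-* k (f ∘ suc) = sym (*-distribˡ-+ k (f zero) _)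

sumF-const : ∀ {n} k → sumF {n} (λ _ → k) ≡ n * k
sumF-const {zero} k = refl
sumF-const {suc n} k = cong (k +_) (sumF-const {n} k)

sumF-swap : ∀ {m n} (f : Fin m → Fin n → ℕ) →
  sumF (λ i → sumF (f i)) ≡ sumF (λ j → sumF (λ i → f i j))
sumF-swap {zero} {n} f = sym (trans (sumF-const {n} 0) (*-zeroʳ n))
sumF-swap {suc m} f = trans (cong (sumF (f zero) +_) (sumF-swap (f ∘ suc)))
  (sym (sumF-+ (f zero) (λ j → sumF (λ i → f (suc i) j))))

count≡sumF : ∀ {n} (p : Fin n → Bool) → count p ≡ sumF (χ ∘ p)
count≡sumF {zero} p = refl
count≡sumF {suc n} p = cong (χ (p zero) +_) (count≡sumF (p ∘ suc))

count-mono : ∀ {n} {p q : Fin n → Bool} → (∀ i → p i ≡ true → q i ≡ true) → count p ≤ count q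
count-mono {zero} h = z≤n
count-mono {suc n} h = +-mono-≤ (χ-mono (h zero)) (count-mono (h ∘ suc))

count-cong : ∀ {n} {p q : Fin n → Bool} → (∀ i → p i ≡ q i) → count p ≡ count q
count-cong h = ≤-antisym (count-mono λ i e → trans (sym (h i)) e) (count-mono λ i e → trans (h i) e)

χ-disjoint : ∀ {a b c} → (a ≡ true → c ≡ true) → (b ≡ true → c ≡ true) →
  (a ≡ true → b ≡ true → ⊥) → χ a + χ b ≤ χ c
χ-disjoint {false} h k d = χ-mono k
χ-disjoint {true} {false} h k d rewrite h refl = ≤-refl
χ-disjoint {true} {true} h k d = ⊥-elim (d refl refl)

count-disjoint : ∀ {n} {p q r : Fin n → Bool} → (∀ i → p i ≡ true → r i ≡ true) →
  (∀ i → q i ≡ true → r i ≡ true) → (∀ i → p i ≡ true → q i ≡ true → ⊥) → count p + count q ≤ count r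
count-disjoint {zero} h k d = z≤n
count-disjoint {suc n} {p} {q} h k d =
  ≤-trans (≤-reflexive (+-interchange (χ (p zero)) (count (p ∘ suc)) (χ (q zero)) (count (q ∘ suc))))
    (+-mono-≤ (χ-disjoint (h zero) (k zero) (d zero)) (count-disjoint (h ∘ suc) (k ∘ suc) (d ∘ suc)))

count-∃ : ∀ {n} {p : Fin n → Bool} → 1 ≤ count p → ∃ λ v → p v ≡ true
count-∃ {suc n} {p} h with p zero in eq
... | true = zero , eq
... | false with count-∃ {n} {p ∘ suc} h
... | v , e = suc v , e

count-zero : ∀ {n} {p : Fin n → Bool} → count p ≤ 0 → ∀ v → p v ≡ true → ⊥
count-zero {suc n} {p} h zero e rewrite e with h
... | ()
count-zero {suc n} {p} h (suc v) e = count-zero (≤-trans (m≤n+m _ (χ (p zero))) h) v e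

infixl 6 _∖_
_∖_ : ∀ {n} → (Fin n → Bool) → Fin n → Fin n → Bool
(p ∖ v) w = p w ∧ not (does (w ≟F v))

∖-elim : ∀ {n} {p : Fin n → Bool} {v w} → (p ∖ v) w ≡ true → p w ≡ true × w ≢ v
∖-elim {v = v} {w} e with ∧-elim e
... | a , b = a , refutation (w ≟F v) b

∖-intro : ∀ {n} {p : Fin n → Bool} {v w} → p w ≡ true → w ≢ v → (p ∖ v) w ≡ true
∖-intro {v = v} {w} a ne = ∧-intro a (cong not (dec-false (w ≟F v) ne))

count-remove : ∀ {n} (p : Fin n → Bool) v → p v ≡ true → count p ≡ suc (count (p ∖ v))
count-remove p zero e rewrite e = cong suc (count-cong λ i → sym (∧-identityʳ (p (suc i))))
count-remove p (suc v) e rewrite count-remove (p ∘ suc) v e | ∧-identityʳ (p zero) =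
  +-suc (χ (p zero)) _

-- Discharging: the three configurations are unavoidable

bigs threes : ∀ {n} → Graph n → Fin n → ℕ
bigs g q = count λ w → adj g q w ∧ does (5 ≤? degree g w)
threes g q = count λ w → adj g q w ∧ does (degree g w ≟ 3)

module _ {n} (g : Graph n) (propA : PropertyA g)
  (noA : ∀ x q → adj g x q ≡ true → degree g x ≤ 2 → 4 ≤ bigs g q)
  (noB : ∀ x q → adj g x q ≡ true → degree g x ≡ 3 → 5 ≤ degree g q)
  (noC : ∀ q → degree g q ≡ 5 → threes g q ≤ 3) where

  private
    deg = degree g
    S three : Fin n → Bool
    S v = does (3 ≤? deg v)
    three v = does (deg v ≟ 3)
    -- For u in `S`, `count (inner u)` is the degree of u in the graph induced on `S`, and
    -- `cubic u v` marks a third of a unit of charge handed from u to v.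
    inner cubic : Fin n → Fin n → Bool
    inner u v = S u ∧ (S v ∧ adj g u v)
    cubic u v = S u ∧ (three v ∧ adj g u v)
    arc : Fin n → Fin n → Bool
    arc u v = S u ∧ S v ∧ adj g u v ∧ does (toℕ u <? toℕ v)

    adj-sym : ∀ {u v} → adj g u v ≡ true → adj g v u ≡ true
    adj-sym {u} {v} e = trans (Graph.sym g v u) e

    S-intro : ∀ {v} → 3 ≤ deg v → S v ≡ true
    S-intro {v} = dec-true (3 ≤? deg v)

    -- A neighbour of degree at most 2 would by `noA` give u four neighbours of degree at least 5,
    -- more than u has.
    no-small-neighbour : ∀ {u} → deg u ≤ 3 → ∀ v → adj g u v ≡ true → S v ≡ true
    no-small-neighbour {u} du v e = S-intro (≮⇒≥ λ <3 → <⇒≱ (s≤s du)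
      (≤-trans (noA v u (adj-sym e) (≤-pred <3)) (count-mono {p = λ w → adj g u w ∧ does (5 ≤? deg w)} {q = adj g u} λ w → proj₁ ∘ ∧-elim)))

    -- `inducedEdges` counts an edge only in the direction of increasing index. An inner pair is an
    -- arc in one direction or the other; equal indices are excluded because there are no loops.
    handshake : sumF (λ u → count (inner u)) ≤ 2 * inducedEdges g S
    handshake = begin
      sumF (λ u → count (inner u))
        ≡⟨ sumF-cong (λ u → count≡sumF (inner u)) ⟩
      sumF (λ u → sumF λ v → χ (inner u v))
        ≤⟨ sumF-mono (λ u → sumF-mono (arcs u)) ⟩
      sumF (λ u → sumF λ v → χ (arc u v) + χ (arc v u))
        ≡⟨ sumF-cong (λ u → sumF-+ (χ ∘ arc u) (λ v → χ (arc v u))) ⟩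
      sumF (λ u → sumF (χ ∘ arc u) + sumF λ v → χ (arc v u))
        ≡⟨ sumF-+ (λ u → sumF (χ ∘ arc u)) (λ u → sumF λ v → χ (arc v u)) ⟩
      sumF (λ u → sumF (χ ∘ arc u)) + sumF (λ u → sumF λ v → χ (arc v u))
        ≡⟨ cong (sumF (λ u → sumF (χ ∘ arc u)) +_) (sym (sumF-swap (λ u v → χ (arc u v)))) ⟩
      sumF (λ u → sumF (χ ∘ arc u)) + sumF (λ u → sumF (χ ∘ arc u))
        ≡⟨ cong₂ _+_ E≡ (trans E≡ (sym (+-identityʳ _))) ⟩
      2 * inducedEdges g S ∎
      where
        open ≤-Reasoning
        E≡ : sumF (λ u → sumF (χ ∘ arc u)) ≡ inducedEdges g S
        E≡ = sumF-cong (λ u → sym (count≡sumF (arc u)))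
        arcs : ∀ u v → χ (inner u v) ≤ χ (arc u v) + χ (arc v u)
        arcs u v with inner u v in eq
        ... | false = z≤n
        ... | true with ∧-elim {S u} eq
        ... | su , e with ∧-elim {S v} e
        ... | sv , a with <-cmp (toℕ u) (toℕ v)
        ... | tri< u<v _ _
          rewrite ∧-intro su (∧-intro sv (∧-intro a (dec-true (toℕ u <? toℕ v) u<v))) = s≤s z≤n
        ... | tri> _ _ v<u
          rewrite ∧-intro sv (∧-intro su (∧-intro (adj-sym a) (dec-true (toℕ v <? toℕ u) v<u))) = m≤n+m 1 _
        ... | tri≈ _ u≡v _ with toℕ-injective u≡v
        ... | refl with trans (sym a) (irrefl g u)
        ... | ()

    -- Three times the discharging inequality, with both sides moved so that no subtraction occurs.
    charge : ∀ u → 12 * χ (S u) + count (cubic u) ≤ 3 * count (inner u) + 3 * χ (three u)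
    charge u with S u in su
    ... | false = ≤-trans (≤-reflexive none) z≤n
      where
        none : 12 * 0 + count {n} (λ _ → false) ≡ 0
        none = trans (count≡sumF {n} (λ _ → false)) (trans (sumF-const {n} 0) (*-zeroʳ n))
    ... | true with three u in tu
    -- A cubic u hands out nothing, as a cubic neighbour would by `noB` force degree 5 on u. All
    -- three neighbours lie in `S`, so the inequality reads 12 ≤ 9 + 3.
    ... | true = begin
            12 + count (λ v → three v ∧ adj g u v)
              ≡⟨ cong (12 +_) (n≤0⇒n≡0 (≮⇒≥ λ h → let v , e = count-∃ h in
                   none v (∧-elim e))) ⟩
            3 * 3 + 3
              ≡⟨ cong (λ z → 3 * z + 3) (sym d≡3) ⟩
            3 * deg u + 3
              ≤⟨ +-monoˡ-≤ 3 (*-monoʳ-≤ 3 (count-mono λ v e →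
                   ∧-intro (no-small-neighbour (≤-reflexive d≡3) v e) e)) ⟩
            3 * count (λ v → S v ∧ adj g u v) + 3 ∎
      where
        open ≤-Reasoning
        d≡3 : deg u ≡ 3
        d≡3 = witness (deg u ≟ 3) tu
        none : ∀ v → three v ≡ true × adj g u v ≡ true → ⊥
        none v (t , e) = <⇒≱ {3} {5} (s≤s (s≤s (s≤s (s≤s z≤n))))
          (≤-trans (noB v u (adj-sym e) (witness (deg v ≟ 3) t)) (≤-reflexive d≡3))
    ... | false with 1 ≤? count (λ v → adj g u v ∧ does (deg v ≤? 2))
    -- A small neighbour of u forces by `noA` four neighbours of degree at least 5. They and the t
    -- cubic neighbours form disjoint parts of `S`, so three times their number is at least 12 + t.
    ... | yes h = begin
            12 + t              ≤⟨ +-mono-≤ (*-monoʳ-≤ 3 big) (m≤m+n t (t + (t + 0))) ⟩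
            3 * bigs g u + 3 * t ≡⟨ sym (*-distribˡ-+ 3 (bigs g u) t) ⟩
            3 * (bigs g u + t)  ≤⟨ *-monoʳ-≤ 3 (count-disjoint
              (λ v e → let a , b = ∧-elim e in
                 ∧-intro (S-intro (≤-trans (s≤s (s≤s (s≤s z≤n))) (witness (5 ≤? deg v) b))) a)
              (λ v e → let b , a = ∧-elim e in
                 ∧-intro (S-intro (≤-reflexive (sym (witness (deg v ≟ 3) b)))) a)
              (λ v e e′ → <⇒≱ {3} {5} (s≤s (s≤s (s≤s (s≤s z≤n))))
                 (≤-trans (witness (5 ≤? deg v) (proj₂ (∧-elim e)))
                   (≤-reflexive (witness (deg v ≟ 3) (proj₁ (∧-elim e′))))))) ⟩
            3 * d*              ≡⟨ sym (+-identityʳ _) ⟩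
            3 * d* + 0 ∎
      where
        open ≤-Reasoning
        t = count (λ v → three v ∧ adj g u v)
        d* = count (λ v → S v ∧ adj g u v)
        big : 4 ≤ bigs g u
        big with count-∃ h
        ... | v , e with ∧-elim {adj g u v} e
        ... | a , b = noA v u (adj-sym a) (witness (deg v ≤? 2) b)
    ... | no ¬small = begin
            12 + t       ≤⟨ bound ⟩
            3 * deg u    ≤⟨ *-monoʳ-≤ 3 (count-mono λ v e → ∧-intro (nbr v e) e) ⟩
            3 * d*       ≡⟨ sym (+-identityʳ _) ⟩
            3 * d* + 0 ∎
      where
        open ≤-Reasoning
        t = count (λ v → three v ∧ adj g u v)
        d* = count (λ v → S v ∧ adj g u v)
        nbr : ∀ v → adj g u v ≡ true → S v ≡ true
        nbr v e = S-intro (≮⇒≥ λ <3 → count-zero (≤-pred (≰⇒> ¬small)) v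
                    (∧-intro e (dec-true (deg v ≤? 2) (≤-pred <3))))
        t≤threes : t ≤ threes g u
        t≤threes = count-mono {p = λ v → three v ∧ adj g u v} {q = λ v → adj g u v ∧ three v}
          λ v e → let a , b = ∧-elim {three v} e in ∧-intro b a
        ten : ∀ k → 12 + (6 + k) ≤ 3 * (6 + k)
        ten k = ≤-trans (+-monoʳ-≤ 18 (m≤m+n k (k + (k + 0)))) (≤-reflexive (lem k))
          where
            lem : ∀ k → 18 + 3 * k ≡ 3 * (6 + k)
            lem = solve-∀
        bound : 12 + t ≤ 3 * deg u
        -- From degree 6 on, t ≤ deg u suffices. At degree 5, `noC` gives t ≤ 3 and 12 + 3 = 15; at
        -- degree 4, `noB` gives t = 0.
        bound with 6 ≤? deg u
        ... | yes 6≤d with m≤n⇒∃[o]m+o≡n 6≤d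
        ... | k , eq = ≤-trans (+-monoʳ-≤ 12 (≤-trans (count-mono {p = λ v → three v ∧ adj g u v} {q = adj g u} λ v → proj₂ ∘ ∧-elim {three v}) (≤-reflexive (sym eq))))
                         (≤-trans (ten k) (≤-reflexive (cong (3 *_) eq)))
        bound | no ¬6 with deg u ≟ 5
        ... | yes d≡5 = ≤-trans (+-monoʳ-≤ 12 (≤-trans t≤threes (noC u d≡5))) (≤-reflexive (cong (3 *_) (sym d≡5)))
        ... | no d≢5 = ≤-trans (≤-reflexive (cong (12 +_) (n≤0⇒n≡0 (≮⇒≥ λ h → let v , e = count-∃ h in
                   none v (∧-elim e))))) (*-monoʳ-≤ 3 4≤d)
          where
            d<5 : deg u < 5
            d<5 = ≤∧≢⇒< (≤-pred (≰⇒> ¬6)) d≢5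
            4≤d : 4 ≤ deg u
            4≤d = ≤∧≢⇒< (witness (3 ≤? deg u) su) λ 3≡d → clash (trans (sym tu) (dec-true (deg u ≟ 3) (sym 3≡d)))
            none : ∀ v → three v ≡ true × adj g u v ≡ true → ⊥
            none v (t , e) = <⇒≱ d<5 (noB v u (adj-sym e) (witness (deg v ≟ 3) t))

    -- The transferred thirds are counted by receiver: all three neighbours of a cubic vertex lie in
    -- `S`, so it gets three of them.
    cubic-sum : sumF (λ v → 3 * χ (three v)) ≤ sumF (λ u → count (cubic u))
    cubic-sum = begin
      sumF (λ v → 3 * χ (three v))               ≤⟨ sumF-mono per ⟩
      sumF (λ v → sumF λ u → χ (cubic u v))      ≡⟨ sym (sumF-swap (λ u v → χ (cubic u v))) ⟩
      sumF (λ u → sumF λ v → χ (cubic u v))      ≡⟨ sumF-cong (λ u → sym (count≡sumF (cubic u))) ⟩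
      sumF (λ u → count (cubic u)) ∎
      where
        open ≤-Reasoning
        per : ∀ v → 3 * χ (three v) ≤ sumF λ u → χ (cubic u v)
        per v with three v in tv
        ... | false = z≤n
        ... | true = ≤-trans (≤-reflexive (sym d≡3))
          (≤-trans (count-mono {q = λ u → S u ∧ adj g u v} λ u e →
              ∧-intro (no-small-neighbour (≤-reflexive d≡3) u e) (adj-sym e))
            (≤-reflexive (count≡sumF λ u → S u ∧ adj g u v)))
          where
            d≡3 : deg v ≡ 3
            d≡3 = witness (deg v ≟ 3) tv

    -- Summing `charge` over all vertices cancels what is given against what is received.
    twelve-size : 12 * size S ≤ 3 * sumF (λ u → count (inner u))
    twelve-size = +-cancelʳ-≤ (sumF (λ u → count (cubic u))) _ _ (begin
      12 * size S + sumF (λ u → count (cubic u))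
        ≡⟨ cong (_+ sumF (λ u → count (cubic u)))
             (trans (cong (12 *_) (count≡sumF S)) (sym (sumF-* 12 (χ ∘ S)))) ⟩
      sumF (λ u → 12 * χ (S u)) + sumF (λ u → count (cubic u))
        ≡⟨ sym (sumF-+ (λ u → 12 * χ (S u)) (λ u → count (cubic u))) ⟩
      sumF (λ u → 12 * χ (S u) + count (cubic u))
        ≤⟨ sumF-mono charge ⟩
      sumF (λ u → 3 * count (inner u) + 3 * χ (three u))
        ≡⟨ sumF-+ (λ u → 3 * count (inner u)) (λ u → 3 * χ (three u)) ⟩
      sumF (λ u → 3 * count (inner u)) + sumF (λ u → 3 * χ (three u))
        ≤⟨ +-mono-≤ (≤-reflexive (sumF-* 3 (λ u → count (inner u)))) cubic-sum ⟩
      3 * sumF (λ u → count (inner u)) + sumF (λ u → count (cubic u)) ∎)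
      where open ≤-Reasoning

  -- With E induced edges on `S`, Property A gives 12 |S| ≤ 6 E < 6 (E + 1) ≤ 12 |S|. The edge xq
  -- makes `S` nonempty: if x is small, `noA` provides vertices of degree at least 5 next to q.
  no-reducible⇒edgeless : ∀ x q → adj g x q ≡ true → ⊥
  no-reducible⇒edgeless x q xq = <-irrefl refl (begin-strict
      12 * size S                             ≤⟨ twelve-size ⟩
      3 * sumF (λ u → count (inner u))        ≤⟨ *-monoʳ-≤ 3 handshake ⟩
      3 * (2 * inducedEdges g S)              <⟨ m<m+n _ {6} (s≤s z≤n) ⟩
      3 * (2 * inducedEdges g S) + 6          ≡⟨ lem (inducedEdges g S) ⟩
      6 * (inducedEdges g S + 1)              ≤⟨ *-monoʳ-≤ 6 (propA S nonempty) ⟩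
      6 * (2 * size S)                        ≡⟨ sym (*-assoc 6 2 (size S)) ⟩
      12 * size S ∎)
    where
      open ≤-Reasoning
      lem : ∀ e → 3 * (2 * e) + 6 ≡ 6 * (e + 1)
      lem = solve-∀
      S-size : ∀ v → S v ≡ true → 1 ≤ size S
      S-size v e rewrite count-remove S v e = s≤s z≤n
      nonempty : 1 ≤ size S
      nonempty with ≤-<-connex 3 (deg x)
      ... | inj₁ h = S-size x (S-intro h)
      ... | inj₂ <3 with count-∃ {p = λ w → adj g q w ∧ does (5 ≤? deg w)}
                         (≤-trans (s≤s z≤n) (noA x q xq (≤-pred <3)))
      ... | w , e = S-size w (S-intro (≤-trans (s≤s (s≤s (s≤s z≤n)))
                      (witness (5 ≤? deg w) (proj₂ (∧-elim e)))))

-- Partial colourings and alternating walks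

same? : ∀ {n} (u v : Fin n) → u ≡ v ⊎ u ≢ v
same? u v with u ≟F v
... | yes e = inj₁ e
... | no ne = inj₂ ne

Partial : ℕ → ℕ → Set
Partial n K = Fin n → Fin n → Maybe (Fin K)

module _ {n K : ℕ} where

  -- Walks are built from pairs of edges, so they have even length, start with colour a and end with
  -- colour b. Under a proper colouring a closed nonempty one with a ≢ b runs around a bichromatic
  -- cycle, which is why `acyc` can speak of walks and need not mention distinct vertices.
  data Walk (c : Partial n K) (a b : Fin K) : Fin n → Fin n → Set where
    []   : ∀ {u} → Walk c a b u u
    step : ∀ {u w v t} → c u w ≡ just a → c w v ≡ just b → Walk c a b v t → Walk c a b u t

  data Walk⁺ (c : Partial n K) (a b : Fin K) (u t : Fin n) : Set where
    step : ∀ {w v} → c u w ≡ just a → c w v ≡ just b → Walk c a b v t → Walk⁺ c a b u t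

  Missing : Partial n K → Fin n → Fin K → Set
  Missing c v a = ∀ w → c v w ≡ just a → ⊥

  record Valid (c : Partial n K) : Set where
    field
      symm   : ∀ u v → c u v ≡ c v u
      loop   : ∀ u → c u u ≡ nothing
      proper : ∀ {u v w a} → c u v ≡ just a → c u w ≡ just a → v ≡ w
      acyc   : ∀ {a b u} → a ≢ b → Walk⁺ c a b u u → ⊥

    flip : ∀ {u v a} → c u v ≡ just a → c v u ≡ just a
    flip {u} {v} e = trans (symm v u) e

  open Valid public

  module _ {c : Partial n K} where

    toWalk : ∀ {a b u v} → Walk⁺ c a b u v → Walk c a b u v
    toWalk (step p q r) = step p q r

    infixr 5 _++ʷ_
    _++ʷ_ : ∀ {a b u v w} → Walk c a b u v → Walk c a b v w → Walk c a b u w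
    [] ++ʷ s = s
    step p q r ++ʷ s = step p q (r ++ʷ s)

    snoc⁺ : ∀ {a b u v w t} → Walk c a b u v → c v w ≡ just a → c w t ≡ just b → Walk⁺ c a b u t
    snoc⁺ [] p q = step p q []
    snoc⁺ (step p′ q′ r) p q = step p′ q′ (toWalk (snoc⁺ r p q))

    -- The same sequence of edges, regrouped into pairs with an offset of one.
    shift : ∀ {a b s u v t} → c s u ≡ just a → Walk c b a u v → c v t ≡ just b → Walk⁺ c a b s t
    shift p [] q = step p q []
    shift p (step p′ q′ r) q = step p p′ (toWalk (shift q′ r q))

    unshift : ∀ {a b s u t} → c s u ≡ just a → Walk c b a u t → ∃ λ v → Walk c a b s v × c v t ≡ just a
    unshift p [] = _ , [] , p
    unshift p (step p′ q′ r) with unshift q′ r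
    ... | v , w , e = v , step p p′ w , e

    Stop : Fin K → Fin K → Fin n → Set
    Stop a b v = ∀ w t → c v w ≡ just a → c w t ≡ just b → ⊥

  module _ {c : Partial n K} (vc : Valid c) where

    reverse : ∀ {a b u v} → Walk c a b u v → Walk c b a v u
    reverse [] = []
    reverse (step p q r) = toWalk (snoc⁺ (reverse r) (flip vc q) (flip vc p))

    reverse⁺ : ∀ {a b u v} → Walk⁺ c a b u v → Walk⁺ c b a v u
    reverse⁺ (step p q r) = snoc⁺ (reverse r) (flip vc q) (flip vc p)

    -- Properness leaves no choice at any step, so one walk is an initial part of the other, and the
    -- shorter one cannot be continued.
    walk-end : ∀ {a b u v v′} → Walk c a b u v → Walk c a b u v′ → Stop {c} a b v → Stop {c} a b v′ → v ≡ v′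
    walk-end [] [] _ _ = refl
    walk-end [] (step p q _) s _ = ⊥-elim (s _ _ p q)
    walk-end (step p q _) [] _ s = ⊥-elim (s _ _ p q)
    walk-end (step p q r) (step p′ q′ r′) s s′ with proper vc p p′
    ... | refl with proper vc q q′
    ... | refl = walk-end r r′ s s′

  private
    -- Alternating walks of odd length, presented from the outside inwards, so that both end edges
    -- can be peeled off at once.
    data Odd (c : Partial n K) (a b : Fin K) : Fin n → Fin n → Set where
      edge : ∀ {u v} → c u v ≡ just a → Odd c a b u v
      wrap : ∀ {u u′ v′ v} → c u u′ ≡ just a → Odd c b a u′ v′ → c v′ v ≡ just a → Odd c a b u v

    cons : ∀ {c a b u s s′ v} → c u s ≡ just a → c s s′ ≡ just b → Odd c a b s′ v → Odd c a b u v
    cons p q (edge r) = wrap p (edge q) r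
    cons p q (wrap p′ o q′) = wrap p (cons q p′ o) q′

    toOdd : ∀ {c a b u s v} → c u s ≡ just b → Walk c a b s v → Odd c b a u v
    toOdd p [] = edge p
    toOdd p (step p′ q′ r) = cons p p′ (toOdd q′ r)

  -- A closed walk that starts and ends with the same colour is a palindrome, and its middle is a loop.
  ¬odd-closed : ∀ {c a b u s} → Valid c → c u s ≡ just b → Walk c a b s u → ⊥
  ¬odd-closed {c} vc p r = go (toOdd p r)
    where
      go : ∀ {a b u} → Odd c a b u u → ⊥
      go {u = u} (edge e) with trans (sym (loop vc u)) e
      ... | ()
      go (wrap p o q) with proper vc p (flip vc q)
      ... | refl = go o

  Valid-⊆ : ∀ {c c′ : Partial n K} → Valid c → (∀ u v → c′ u v ≡ c′ v u) →
    (∀ {u v a} → c′ u v ≡ just a → c u v ≡ just a) → Valid c′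
  Walk-⊆ : ∀ {c c′ : Partial n K} → (∀ {u v a} → c′ u v ≡ just a → c u v ≡ just a) →
    ∀ {a b u v} → Walk c′ a b u v → Walk c a b u v
  Walk⁺-⊆ : ∀ {c c′ : Partial n K} → (∀ {u v a} → c′ u v ≡ just a → c u v ≡ just a) →
    ∀ {a b u v} → Walk⁺ c′ a b u v → Walk⁺ c a b u v

  Walk-⊆ h [] = []
  Walk-⊆ h (step p q r) = step (h p) (h q) (Walk-⊆ h r)
  Walk⁺-⊆ h (step p q r) = step (h p) (h q) (Walk-⊆ h r)
  Valid-⊆ {c} {c′} vc sy h = record
    { symm = sy ; loop = lp ; proper = λ p q → proper vc (h p) (h q) ; acyc = λ ne w → acyc vc ne (Walk⁺-⊆ h w) }
    where
      lp : ∀ u → c′ u u ≡ nothing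
      lp u with c′ u u in eq
      ... | nothing = refl
      ... | just a with trans (sym (loop vc u)) (h eq)
      ... | ()

  -- Colouring all edges at one vertex

  opaque
    star : Fin n → (Fin n → Maybe (Fin K)) → Partial n K → Partial n K
    star x f c u v = if does (u ≟F x) then f v else if does (v ≟F x) then f u else c u v

  module _ (x : Fin n) (f : Fin n → Maybe (Fin K)) (c : Partial n K) where

    opaque
      unfolding star

      star-from : ∀ v → star x f c x v ≡ f v
      star-from v rewrite dec-true (x ≟F x) refl = refl

      star-to : ∀ u → star x f c u x ≡ f u
      star-to u with u ≟F x
      ... | yes refl = refl
      ... | no _ rewrite dec-true (x ≟F x) refl = refl

      star-off : ∀ {u v} → u ≢ x → v ≢ x → star x f c u v ≡ c u v
      star-off {u} {v} nu nv rewrite dec-false (u ≟F x) nu | dec-false (v ≟F x) nv = refl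

      star-sym : (∀ u v → c u v ≡ c v u) → ∀ u v → star x f c u v ≡ star x f c v u
      star-sym sy u v with u ≟F x | v ≟F x
      ... | yes refl | yes refl = refl
      ... | yes _ | no _ = refl
      ... | no _ | yes _ = refl
      ... | no _ | no _ = sy u v

    module _ (vc : Valid c) (fx : f x ≡ nothing)
      (f-inj : ∀ {u v a} → f u ≡ just a → f v ≡ just a → u ≡ v)
      (f-miss : ∀ {u a} → f u ≡ just a → Missing c u a)
      -- With xu coloured a and xv coloured b, such a walk would close through x to a bichromatic
      -- cycle.
      (f-safe : ∀ {u v a b} → f u ≡ just a → f v ≡ just b → a ≢ b → Walk⁺ c b a u v → ⊥) where

      private
        c⁺ = star x f c

        lp : ∀ u → c⁺ u u ≡ nothing
        lp u with same? u x
        ... | inj₁ refl = trans (star-from x) fx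
        ... | inj₂ u≢x = trans (star-off u≢x u≢x) (loop vc u)

        pr : ∀ {u v w a} → c⁺ u v ≡ just a → c⁺ u w ≡ just a → v ≡ w
        pr {u} {v} {w} p q with same? u x
        ... | inj₁ refl = f-inj (trans (sym (star-from v)) p) (trans (sym (star-from w)) q)
        ... | inj₂ u≢x with same? v x | same? w x
        ... | inj₁ refl | inj₁ refl = refl
        ... | inj₁ refl | inj₂ w≢x =
          ⊥-elim (f-miss (trans (sym (star-to u)) p) w (trans (sym (star-off u≢x w≢x)) q))
        ... | inj₂ v≢x | inj₁ refl =
          ⊥-elim (f-miss (trans (sym (star-to u)) q) v (trans (sym (star-off u≢x v≢x)) p))
        ... | inj₂ v≢x | inj₂ w≢x =
          proper vc (trans (sym (star-off u≢x v≢x)) p) (trans (sym (star-off u≢x w≢x)) q)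

        sy = star-sym (symm vc)

        off : ∀ {u v a} → u ≢ x → v ≢ x → c⁺ u v ≡ just a → c u v ≡ just a
        off nu nv e = trans (sym (star-off nu nv)) e

        -- The parity is that of the position at which the walk meets x: `even` between two pairs of
        -- edges, `odd` in the middle of a pair.
        data Visit (a b : Fin K) (s t : Fin n) (W : Set) : Set where
          avoid : W → Visit a b s t W
          even  : Walk c⁺ a b s x → Walk c⁺ a b x t → Visit a b s t W
          odd   : ∀ {u v} → Walk c⁺ a b s u → c⁺ u x ≡ just a → c⁺ x v ≡ just b → Walk c⁺ a b v t →
                  Visit a b s t W

        visit : ∀ {a b s t} → Walk c⁺ a b s t → Visit a b s t (Walk c a b s t)
        visit⁺ : ∀ {a b s w v t} → c⁺ s w ≡ just a → c⁺ w v ≡ just b → Walk c⁺ a b v t →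
          Visit a b s t (Walk⁺ c a b s t)

        visit [] = avoid []
        visit (step p q r) with visit⁺ p q r
        ... | avoid r′ = avoid (toWalk r′)
        ... | even r₁ r₂ = even r₁ r₂
        ... | odd r₁ p′ q′ r₂ = odd r₁ p′ q′ r₂
        visit⁺ {s = s} {w} {v} p q r with same? s x | same? w x | same? v x
        ... | inj₁ refl | _ | _ = even [] (step p q r)
        ... | inj₂ s≢x | inj₁ refl | _ = odd [] p q r
        ... | inj₂ s≢x | inj₂ w≢x | inj₁ refl = even (step p q []) r
        ... | inj₂ s≢x | inj₂ w≢x | inj₂ v≢x with visit r
        ... | even r₁ r₂ = even (step p q r₁) r₂
        ... | odd r₁ p′ q′ r₂ = odd (step p q r₁) p′ q′ r₂
        ... | avoid r′ = avoid (step (off s≢x w≢x p) (off w≢x v≢x q) r′)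

        data Hit (a b : Fin K) (s : Fin n) : Set where
          odd  : ∀ {v} → Walk c a b s v → f v ≡ just a → Hit a b s
          even : ∀ {u v} → Walk c a b s u → c u v ≡ just a → f v ≡ just b → Hit a b s

        first-hit : ∀ {a b s t} → t ≡ x → s ≢ x → Walk c⁺ a b s t → Hit a b s
        first-hit t≡x s≢x [] = ⊥-elim (s≢x t≡x)
        first-hit {s = s} t≡x s≢x (step {w = w} {v} p q r) with same? w x | same? v x
        ... | inj₁ refl | _ = odd [] (trans (sym (star-to s)) p)
        ... | inj₂ w≢x | inj₁ refl = even [] (off s≢x w≢x p) (trans (sym (star-to w)) q)
        ... | inj₂ w≢x | inj₂ v≢x with first-hit t≡x v≢x r
        ... | odd r′ e = odd (step (off s≢x w≢x p) (off w≢x v≢x q) r′) e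
        ... | even r′ p′ e = even (step (off s≢x w≢x p) (off w≢x v≢x q) r′) p′ e

        f≢x : ∀ {u a} → f u ≡ just a → u ≢ x
        f≢x e refl with trans (sym fx) e
        ... | ()

        -- Up to its first return to x the walk runs in c. If it returns along the edge coloured b,
        -- `f-safe` excludes it; if along an edge coloured a, this is the edge it left by, and
        -- `¬odd-closed` applies.
        ¬closed-at-x : ∀ {a b} → a ≢ b → Walk⁺ c⁺ a b x x → ⊥
        ¬closed-at-x a≢b (step {u} {s} p q r) with trans (sym (star-from u)) p
        ... | fu with same? s x
        ... | inj₁ refl = a≢b (just-injective (trans (sym fu) (trans (sym (star-to u)) q)))
        ... | inj₂ s≢x with off (f≢x fu) s≢x q | first-hit refl s≢x r
        ... | us | even r′ e fv = f-safe fu fv a≢b (shift us r′ e)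
        ... | us | odd r′ fv with f-inj fu fv
        ... | refl = ¬odd-closed vc us r′

        -- A closed walk that meets x is rotated to start there. If x lies in the middle of a pair,
        -- the rotation exchanges the two colours.
        ac : ∀ {a b u} → a ≢ b → Walk⁺ c⁺ a b u u → ⊥
        ac a≢b (step p q r) with visit⁺ p q r
        ... | even r₁ r₂ = closed r₂ r₁
          where
            closed : Walk c⁺ _ _ x _ → Walk c⁺ _ _ _ x → ⊥
            closed [] [] = ¬closed-at-x a≢b (step p q r)
            closed [] (step p′ q′ r′) = ¬closed-at-x a≢b (step p′ q′ r′)
            closed (step p′ q′ r′) r″ = ¬closed-at-x a≢b (step p′ q′ (r′ ++ʷ r″))
        ... | odd r₁ p′ q′ r₂ = ¬closed-at-x (λ e → a≢b (sym e)) (shift q′ (r₂ ++ʷ r₁) p′)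
        ... | avoid r′ = acyc vc a≢b r′

      star-valid : Valid c⁺
      star-valid = record { symm = sy ; loop = lp ; proper = λ {u} → pr {u} ; acyc = ac }

-- Lists of used colours and choice of colours by pigeonhole

consMaybe : ∀ {A : Set} → Maybe A → List A → List A
consMaybe nothing l = l
consMaybe (just a) l = a ∷ l

collect : ∀ {n} {A : Set} → (Fin n → Maybe A) → List A
collect {zero} h = []
collect {suc n} h = consMaybe (h zero) (collect (h ∘ suc))

∈-collect : ∀ {n} {A : Set} {a : A} (h : Fin n → Maybe A) w → h w ≡ just a → a ∈ collect h
∈-collect h zero e rewrite e = here refl
∈-collect h (suc w) e with h zero
... | nothing = ∈-collect (h ∘ suc) w e
... | just _ = there (∈-collect (h ∘ suc) w e)

length-collect : ∀ {n} {A : Set} {p : Fin n → Bool} (h : Fin n → Maybe A) →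
  (∀ w {a} → h w ≡ just a → p w ≡ true) → length (collect h) ≤ count p
length-collect {zero} h k = z≤n
length-collect {suc n} {p = p} h k with h zero in eq
... | nothing = ≤-trans (length-collect (h ∘ suc) (k ∘ suc)) (m≤n+m _ (χ (p zero)))
... | just a rewrite k zero eq = s≤s (length-collect (h ∘ suc) (k ∘ suc))

module _ {K : ℕ} where

  occ : Fin K → List (Fin K) → ℕ
  occ a [] = 0
  occ a (b ∷ l) = χ (does (a ≟F b)) + occ a l

  occ-++ : ∀ a l m → occ a (l ++ m) ≡ occ a l + occ a m
  occ-++ a [] m = refl
  occ-++ a (b ∷ l) m rewrite occ-++ a l m = sym (+-assoc (χ (does (a ≟F b))) _ _)

  occ-∈ : ∀ {a l} → a ∈ l → 1 ≤ occ a l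
  occ-∈ {a} (here refl) rewrite dec-true (a ≟F a) refl = s≤s z≤n
  occ-∈ {a} {b ∷ l} (there i) = ≤-trans (occ-∈ i) (m≤n+m _ (χ (does (a ≟F b))))

  occ-sum : ∀ l → sumF (λ a → occ a l) ≡ length l
  occ-sum [] = trans (sumF-const {K} 0) (*-zeroʳ K)
  occ-sum (b ∷ l) = trans (sumF-+ (λ a → χ (does (a ≟F b))) (λ a → occ a l)) (cong₂ _+_ one (occ-sum l))
    where
      p : Fin K → Bool
      p a = does (a ≟F b)
      one : sumF (χ ∘ p) ≡ 1
      one = trans (sym (count≡sumF p)) (trans (count-remove p b (dec-true (b ≟F b) refl))
        (cong suc (n≤0⇒n≡0 (≮⇒≥ λ h → let v , e = count-∃ h ; pv , v≢b = ∖-elim {p = p} e in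
          v≢b (witness (v ≟F b) pv)))))

  -- If every colour occurred at least r + 1 times, the list would have at least K (r + 1) entries.
  pick : ∀ r l → length l < K * suc r → ∃ λ a → occ a l ≤ r
  pick r l len with ¬∀⟶∃¬ K (λ a → suc r ≤ occ a l) (λ a → suc r ≤? occ a l)
    (λ all → <⇒≱ len (≤-trans (≤-reflexive (sym (sumF-const {K} (suc r))))
      (≤-trans (sumF-mono all) (≤-reflexive (occ-sum l)))))
  ... | a , ¬le = a , ≤-pred (≰⇒> ¬le)

  fresh : ∀ l → length l < K → ∃ λ a → a ∉ l
  fresh l len with pick 0 l (subst (length l <_) (sym (*-identityʳ K)) len)
  ... | a , e = a , λ i → <⇒≱ (s≤s e) (occ-∈ i)

assoc : ∀ {n} {A : Set} → List (Fin n × A) → Fin n → Maybe A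
assoc [] v = nothing
assoc ((w , a) ∷ l) v = if does (v ≟F w) then just a else assoc l v

assoc-∈ : ∀ {n} {A : Set} {a : A} (l : List (Fin n × A)) {v} → assoc l v ≡ just a → (v , a) ∈ l
assoc-∈ ((w , b) ∷ l) {v} e with v ≟F w
... | yes refl with e
... | refl = here refl
assoc-∈ ((w , b) ∷ l) {v} e | no _ = there (assoc-∈ l e)

-- The colour found may differ from a, since an earlier entry for v takes precedence.
∈-assoc : ∀ {n} {A : Set} {a : A} (l : List (Fin n × A)) {v} → (v , a) ∈ l → ∃ λ b → assoc l v ≡ just b
∈-assoc ((w , b) ∷ l) {v} i with v ≟F w | i
... | yes _ | _ = b , refl
... | no v≢w | here refl = ⊥-elim (v≢w refl)
... | no _ | there j = ∈-assoc l j

-- The uncoloured star of a cubic vertex: colours missing at its neighbours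

-- The edges xy, xz, xq at a common neighbour x are uncoloured. If xy gets α and xz gets β, a bichromatic
-- cycle through x is a walk from y to z that starts with β and ends with α, that is, Walk⁺ c β α y z.
record Hole {n K} (c : Partial n K) (q y z : Fin n) (α₀ β₀ : Fin K) : Set where
  field
    valid : Valid c
    y≢z : y ≢ z
    y≢q : y ≢ q
    z≢q : z ≢ q
    len-y : length (collect (c y)) + 4 ≤ K
    len-z : length (collect (c z)) + 4 ≤ K
    len-q : length (collect (c q)) + 4 ≤ K
    miss-y : Missing c y α₀
    miss-z : Missing c z β₀
    α≢β : α₀ ≢ β₀
    free : ¬ Walk⁺ c β₀ α₀ y z
    ¬extend : ∀ {α β γ} → Missing c y α → Missing c z β → Missing c q γ → α ≢ β → α ≢ γ → β ≢ γ →
      ¬ Walk⁺ c β α y z → ¬ Walk⁺ c γ α y q → ¬ Walk⁺ c γ β z q → ⊥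

∉⇒Missing : ∀ {n K} {c : Partial n K} {v a} → a ∉ collect (c v) → Missing c v a
∉⇒Missing {c = c} {v} ∉ w e = ∉ (∈-collect (c v) w e)

first-edge : ∀ {n K} {c : Partial n K} {a b u v} → Walk⁺ c a b u v → ∃ λ w → ∃ λ s → c u w ≡ just a × c w s ≡ just b
first-edge (step p q r) = _ , _ , p , q

¬start : ∀ {n K} {c : Partial n K} {a b u v} → Missing c u a → Walk⁺ c a b u v → ⊥
¬start m (step p q r) = m _ p

¬end : ∀ {n K} {c : Partial n K} {a b u v} → Valid c → Missing c v b → Walk⁺ c a b u v → ⊥
¬end vc m w = ¬start m (reverse⁺ vc w)

∉-∷ : ∀ {A : Set} {a b : A} {l} → a ∉ b ∷ l → b ≢ a × a ∉ l
∉-∷ ∉ = (λ e → ∉ (here (sym e))) , ∉ ∘ there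

-- Meant for the list `l` of colours at a neighbour of x: having lost its edge to x it misses at
-- least four colours, so three may still be forbidden.
fresh-beyond : ∀ {K} (l m : List (Fin K)) → length l + 4 ≤ K → length m ≤ 3 → ∃ λ a → a ∉ l × a ∉ m
fresh-beyond {K} l m hl hm with fresh (l ++ m) (begin-strict
      length (l ++ m)      ≡⟨ length-++ l ⟩
      length l + length m  ≤⟨ +-monoʳ-≤ (length l) hm ⟩
      length l + 3         <⟨ +-monoʳ-< (length l) ≤-refl ⟩
      length l + 4         ≤⟨ hl ⟩
      K ∎)
  where open ≤-Reasoning
... | a , ∉ = a , ∉ ∘ ∈-++⁺ˡ , ∉ ∘ ∈-++⁺ʳ l

module _ {n K} {c : Partial n K} {q : Fin n} where

  swap : ∀ {y z α β} → Hole c q y z α β → Hole c q z y β α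
  swap h = record
    { valid = valid ; y≢z = y≢z ∘ sym ; y≢q = z≢q ; z≢q = y≢q ; len-y = len-z ; len-z = len-y ; len-q = len-q
    ; miss-y = miss-z ; miss-z = miss-y ; α≢β = α≢β ∘ sym ; free = free ∘ reverse⁺ valid
    ; ¬extend = λ m m′ m″ d d′ d″ w w′ w″ →
        ¬extend m′ m m″ (d ∘ sym) d″ d′ (w ∘ reverse⁺ valid) w″ w′ }
    where open Hole h

  module _ {y z α₀ β₀} (h : Hole c q y z α₀ β₀) where
    open Hole h

    private
      -- Both walks leave u with the same colours and stop where a is missing. Hence for two given
      -- colours at most one pair of the three neighbours is joined.
      meet : ∀ {a b u s t} → Missing c s a → Missing c t a → s ≢ t → Walk⁺ c a b u s → Walk⁺ c a b u t → ⊥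
      meet ms mt s≢t w w′ = s≢t (walk-end valid (toWalk w) (toWalk w′) (λ _ _ e _ → ms _ e) (λ _ _ e _ → mt _ e))

    -- If (b , d) is free, any γ will do. Otherwise (α , d , b) shows that no (α , d) is free, and then
    -- (α₀ , β₀ , d) extends the colouring.
    ¬both-missing : ∀ {b d} → Missing c y b → Missing c q b → Missing c z d → Missing c q d → b ≢ d → ⊥
    ¬both-missing {b} {d} yb qb zd qd b≢d with fresh-beyond (collect (c q)) (b ∷ d ∷ []) len-q (s≤s (s≤s z≤n))
    ... | γ , γ∉q , γ∉ with ∉-∷ γ∉
    ... | b≢γ , γ∉′ with ∉-∷ γ∉′
    ... | d≢γ , _ = blocked miss-y λ w →
            ¬extend miss-y miss-z qd α≢β (λ { refl → ¬start miss-y w }) (λ { refl → free w })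
              free (meet zd qd z≢q w) (¬start zd)
      where
        blocked-b : ¬ ¬ Walk⁺ c d b y z
        blocked-b nw = ¬extend yb zd (∉⇒Missing {c = c} γ∉q) b≢d b≢γ d≢γ nw (¬end valid qb) (¬end valid qd)
        blocked : ∀ {α} → Missing c y α → ¬ ¬ Walk⁺ c d α y z
        blocked {α} yα nw with α ≟F b
        ... | yes refl = blocked-b nw
        ... | no α≢b = blocked-b λ w → ¬extend yα zd qb (λ { refl → ¬start yα w }) α≢b (b≢d ∘ sym)
                         nw (¬start yb) (¬end valid qd)

    -- (α , t , γ) and (t , α , γ) are blocked only by (γ , α)-walks from q to y and to z, respectively.
    ¬common-missing : ∀ {t α} → Missing c y t → Missing c z t → Missing c q t →
      Missing c y α → Missing c z α → α ≢ t → ⊥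
    ¬common-missing {t} {α} yt zt qt yα zα α≢t
      with fresh-beyond (collect (c q)) (t ∷ α ∷ []) len-q (s≤s (s≤s z≤n))
    ... | γ , γ∉q , γ∉ with ∉-∷ γ∉
    ... | t≢γ , γ∉′ with ∉-∷ γ∉′
    ... | α≢γ , _ =
      ¬extend yα zt qγ α≢t α≢γ t≢γ (¬start yt) (λ w →
        ¬extend yt zα qγ (α≢t ∘ sym) t≢γ α≢γ (¬start yα) (¬end valid qt) (λ w′ →
          meet yα zα y≢z (reverse⁺ valid w) (reverse⁺ valid w′)) )
        (¬end valid qt)
      where qγ = ∉⇒Missing {c = c} γ∉q

    -- Only the case of one common colour t remains. Counting finds a colour α ≢ t that is used at
    -- no more than one of y, z, q. If it is used at y or at z, then t and α serve in
    -- `¬both-missing`; otherwise both are missing at y and z, and `¬common-missing` applies.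
    ¬missing-on-both-sides : length (collect (c q)) ≤ 4 → ∀ {b d} →
      Missing c y b → Missing c q b → Missing c z d → Missing c q d → ⊥
    ¬missing-on-both-sides lq {t} {d} yb qb zd qd with t ≟F d
    ... | no t≢d = ¬both-missing yb qb zd qd t≢d
    -- Listing t twice keeps `pick 1` from choosing it. The list has at most |c y| + |c z| + 6
    -- entries, while 2K is at least |c y| + |c z| + 8.
    ... | yes refl with pick 1 (collect (c y) ++ collect (c z) ++ t ∷ t ∷ collect (c q)) bound
      where
        ly = length (collect (c y))
        lz = length (collect (c z))
        arith : ∀ a b → a + (b + (2 + 4)) + 2 ≡ (a + 4) + (b + 4)
        arith = solve-∀
        bound : length (collect (c y) ++ collect (c z) ++ t ∷ t ∷ collect (c q)) < K * 2
        bound = begin-strict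
          length (collect (c y) ++ collect (c z) ++ t ∷ t ∷ collect (c q))
            ≡⟨ trans (length-++ (collect (c y))) (cong (ly +_) (length-++ (collect (c z)))) ⟩
          ly + (lz + (2 + length (collect (c q))))
            ≤⟨ +-monoʳ-≤ ly (+-monoʳ-≤ lz (+-monoʳ-≤ 2 lq)) ⟩
          ly + (lz + (2 + 4))
            <⟨ m<m+n _ {2} (s≤s z≤n) ⟩
          ly + (lz + (2 + 4)) + 2
            ≡⟨ arith ly lz ⟩
          (ly + 4) + (lz + 4)
            ≤⟨ +-mono-≤ len-y len-z ⟩
          K + K
            ≡⟨ trans (cong (K +_) (sym (+-identityʳ K))) (*-comm 2 K) ⟩
          K * 2 ∎
          where open ≤-Reasoning
    ... | α , rare = decide
      where
        oy = occ α (collect (c y))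
        oz = occ α (collect (c z))
        oq = occ α (collect (c q))
        total : oy + (oz + (χ (does (α ≟F t)) + (χ (does (α ≟F t)) + oq))) ≤ 1
        total = subst (_≤ 1) (trans (occ-++ α (collect (c y)) _) (cong (oy +_) (occ-++ α (collect (c z)) _))) rare
        α≢t : α ≢ t
        α≢t refl with total
        ... | le rewrite dec-true (α ≟F α) refl =
          <⇒≱ (s≤s (s≤s z≤n)) (≤-trans (m≤n+m (2 + oq) oz) (≤-trans (m≤n+m _ oy) le))
        rest : oy + (oz + oq) ≤ 1
        rest with total
        ... | le rewrite dec-false (α ≟F t) α≢t = le
        miss : ∀ {v} → occ α (collect (c v)) ≤ 0 → Missing c v α
        miss z0 = ∉⇒Missing {c = c} λ i → <⇒≱ (s≤s z0) (occ-∈ i)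
        decide : ⊥
        decide with 1 ≤? oy | 1 ≤? oz
        ... | yes y1 | _ = ¬both-missing yb qb (miss (m+n≤o⇒m≤o oz z0)) (miss (m+n≤o⇒n≤o oz z0)) (α≢t ∘ sym)
          where z0 = +-cancelˡ-≤ 1 _ _ (≤-trans (+-monoˡ-≤ (oz + oq) y1) rest)
        ... | no y0 | yes z1 = ¬both-missing (miss (≤-pred (≰⇒> y0))) (miss q0) zd qd α≢t
          where q0 = +-cancelˡ-≤ 1 _ _ (≤-trans (+-monoˡ-≤ oq z1) (m+n≤o⇒n≤o oy rest))
        ... | no y0 | no z0 = ¬common-missing yb zd qb (miss (≤-pred (≰⇒> y0))) (miss (≤-pred (≰⇒> z0))) α≢t

-- Colourings of a graph and of a graph minus an edge

Colours : ∀ {n K} → Graph n → Partial n K → Set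
Colours g c = ∀ u v → is-just (c u v) ≡ adj g u v

-- c colours g with the edge xq removed (c x q itself is not constrained).
record Except {n K} (g : Graph n) (x q : Fin n) (c : Partial n K) : Set where
  field
    valid : Valid c
    off   : ∀ {u v} → u ≢ x → v ≢ x → is-just (c u v) ≡ adj g u v
    at    : ∀ {w} → w ≢ q → is-just (c x w) ≡ adj g x w

is-just-just : ∀ {A : Set} {m : Maybe A} → is-just m ≡ true → ∃ λ a → m ≡ just a
is-just-just {m = just a} _ = a , refl

restrict : ∀ {n} {A : Set} → (Fin n → Bool) → (Fin n → Maybe A) → Fin n → Maybe A
restrict p h w = if p w then h w else nothing

restrict-just : ∀ {n} {A : Set} {p : Fin n → Bool} {h : Fin n → Maybe A} {w a} →
  restrict p h w ≡ just a → p w ≡ true × h w ≡ just a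
restrict-just {p = p} {w = w} e with p w
... | true = refl , e

just-restrict : ∀ {n} {A : Set} {p : Fin n → Bool} {h : Fin n → Maybe A} {w a} →
  p w ≡ true → h w ≡ just a → restrict p h w ≡ just a
just-restrict pw e rewrite pw = e

others : ∀ {n K} → Partial n K → Fin n → Fin n → List (Fin K)
others c v e = collect (restrict (λ w → not (does (w ≟F e))) (c v))

∈-others : ∀ {n K} {c : Partial n K} {v e w a} → w ≢ e → c v w ≡ just a → a ∈ others c v e
∈-others {c = c} {v} {e} {w} w≢e eq =
  ∈-collect (restrict (λ w → not (does (w ≟F e))) (c v)) w
    (just-restrict {p = λ w → not (does (w ≟F e))} {h = c v} (cong not (dec-false (w ≟F e) w≢e)) eq)

length-others : ∀ {n K} {c : Partial n K} {v e} {p : Fin n → Bool} →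
  (∀ {w a} → c v w ≡ just a → p w ≡ true) → length (others c v e) ≤ count (p ∖ e)
length-others {c = c} {v} {e} h = length-collect (restrict (λ w → not (does (w ≟F e))) (c v))
  λ w eq → let ne , eq′ = restrict-just {p = λ w → not (does (w ≟F e))} {h = c v} {w = w} eq in ∧-intro (h eq′) ne

wipe : ∀ {n K} → Fin n → Partial n K → Partial n K
wipe x = star x (λ _ → nothing)

module _ {n K} {c : Partial n K} {x : Fin n} where

  wipe-edge : ∀ {u v a} → wipe x c u v ≡ just a → (u ≢ x × v ≢ x) × c u v ≡ just a
  wipe-edge {u} {v} e with same? u x | same? v x
  ... | inj₁ refl | _ with trans (sym (star-from x _ c v)) e
  ... | ()
  wipe-edge {u} {v} e | inj₂ _ | inj₁ refl with trans (sym (star-to x _ c u)) e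
  ... | ()
  wipe-edge e | inj₂ u≢x | inj₂ v≢x = (u≢x , v≢x) , trans (sym (star-off x _ c u≢x v≢x)) e

  wipe-valid : Valid c → Valid (wipe x c)
  wipe-valid vc = Valid-⊆ vc (star-sym x _ c (symm vc)) (proj₂ ∘ wipe-edge)

-- Reducibility of small and cubic vertices

module Minimal {n K} (g : Graph n) (room : ∀ v → degree g v + 3 ≤ K)
  (uncolourable : ∀ (c : Partial n K) → Valid c → Colours g c → ⊥) where

  adj-sym : ∀ {u v} → adj g u v ≡ true → adj g v u ≡ true
  adj-sym {u} {v} e = trans (Graph.sym g v u) e

  adj-≢ : ∀ {u v} → adj g u v ≡ true → u ≢ v
  adj-≢ {u} e refl with trans (sym e) (irrefl g u)
  ... | ()

  degree-∖ : ∀ {v e k} → adj g v e ≡ true → degree g v ≡ suc k → count (adj g v ∖ e) ≡ k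
  degree-∖ {v} {e} ve d = suc-injective (trans (sym (count-remove (adj g v) e ve)) d)

  module _ {x : Fin n} (l : List (Fin n × Fin K))
    (sound : ∀ {v a} → (v , a) ∈ l → adj g x v ≡ true)
    (complete : ∀ v → adj g x v ≡ true → ∃ λ a → (v , a) ∈ l) where

    assoc-adj : ∀ v → is-just (assoc l v) ≡ adj g x v
    assoc-adj v with adj g x v in eq
    ... | true with complete v eq
    ... | a , i with ∈-assoc l i
    ... | b , e rewrite e = refl
    assoc-adj v | false with assoc l v in e
    ... | nothing = refl
    ... | just a with trans (sym eq) (sound (assoc-∈ l e))
    ... | ()

    assoc-loop : assoc l x ≡ nothing
    assoc-loop with assoc l x in e
    ... | nothing = refl
    ... | just a with adj-≢ (sound (assoc-∈ l e)) refl
    ... | ()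

  module Deleted {x q : Fin n} (xq : adj g x q ≡ true) {c′ : Partial n K} (ex : Except g x q c′) where
    open Except ex renaming (valid to valid′)

    c : Partial n K
    c = wipe x c′

    valid : Valid c
    valid = wipe-valid valid′

    edge-adj : ∀ {u v a} → c u v ≡ just a → (u ≢ x × v ≢ x) × adj g u v ≡ true
    edge-adj {u} {v} e with wipe-edge {c = c′} e
    ... | (u≢x , v≢x) , e′ = (u≢x , v≢x) , trans (sym (off u≢x v≢x)) (cong is-just e′)

    adj-edge : ∀ {u v} → u ≢ x → v ≢ x → adj g u v ≡ true → ∃ λ a → c u v ≡ just a
    adj-edge {u} {v} u≢x v≢x e =
      is-just-just (trans (cong is-just (star-off x _ c′ u≢x v≢x)) (trans (off u≢x v≢x) e))

    -- The edge vx is uncoloured, so v sees at most deg v - 1 colours; by `room` at least four are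
    -- missing.
    few : ∀ {v} → adj g x v ≡ true → length (collect (c v)) + 4 ≤ K
    few {v} xv = begin
      length (collect (c v)) + 4        ≤⟨ +-monoˡ-≤ 4 (length-collect (c v) λ w e →
        let (_ , w≢x) , a = edge-adj e in ∖-intro {p = adj g v} a w≢x) ⟩
      count (adj g v ∖ x) + 4           ≡⟨ +-suc (count (adj g v ∖ x)) 3 ⟩
      suc (count (adj g v ∖ x)) + 3     ≡⟨ cong (_+ 3) (sym (count-remove (adj g v) x (adj-sym xv))) ⟩
      degree g v + 3                    ≤⟨ room v ⟩
      K ∎
      where open ≤-Reasoning

    len-others : ∀ {v e k} → adj g v e ≡ true → degree g v ≤ suc k → length (others c v e) ≤ k
    len-others {v} {e} {k} ve d = ≤-trans (length-others {c = c} (proj₂ ∘ edge-adj))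
      (≤-pred (≤-trans (≤-reflexive (sym (count-remove (adj g v) e ve))) d))

    -- The list assigns colours to the edges at x; under these conditions `star-valid` would
    -- complete c to a colouring of g.
    ¬star : (l : List (Fin n × Fin K)) →
      (∀ {v a} → (v , a) ∈ l → adj g x v ≡ true × Missing c v a) →
      (∀ v → adj g x v ≡ true → ∃ λ a → (v , a) ∈ l) →
      (∀ {u v a} → (u , a) ∈ l → (v , a) ∈ l → u ≡ v) →
      (∀ {u v a b} → (u , a) ∈ l → (v , b) ∈ l → a ≢ b → ¬ Walk⁺ c b a u v) → ⊥
    ¬star l sound complete inj safe = uncolourable (star x (assoc l) c)
      (star-valid x (assoc l) c valid (assoc-loop l (proj₁ ∘ sound) complete)
        (λ p q → inj (assoc-∈ l p) (assoc-∈ l q)) (λ p → proj₂ (sound (assoc-∈ l p)))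
        (λ p q → safe (assoc-∈ l p) (assoc-∈ l q)))
      colours
      where
        colours : Colours g (star x (assoc l) c)
        colours u v with same? u x | same? v x
        ... | inj₁ refl | _ = trans (cong is-just (star-from x (assoc l) c v)) (assoc-adj l (proj₁ ∘ sound) complete v)
        ... | inj₂ _ | inj₁ refl = trans (cong is-just (star-to x (assoc l) c u))
              (trans (assoc-adj l (proj₁ ∘ sound) complete u) (Graph.sym g x u))
        ... | inj₂ u≢x | inj₂ v≢x = trans (cong is-just (star-off x (assoc l) c u≢x v≢x))
              (trans (cong is-just (star-off x _ c′ u≢x v≢x)) (off u≢x v≢x))

  -- If q is the only neighbour of x, any colour missing at q works. Otherwise xy gets an α missing
  -- at y and different from the at most three colours on edges from q to vertices of degree at
  -- least 5; it remains to choose γ for xq such that no (γ , α)-walk joins y to q.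
  low-degree-reducible : ∀ {x q c} → adj g x q ≡ true → Except g x q c → degree g x ≤ 2 → bigs g q ≤ 3 → ⊥
  low-degree-reducible {x} {q} {c′} xq ex d2 big3 with 1 ≤? count (adj g x ∖ q)
  ... | no none with fresh-beyond (collect (c q)) [] (few xq) z≤n
    where open Deleted xq ex
  ... | γ , γ∉ , _ = ¬star ((q , γ) ∷ [])
      (λ { (here refl) → xq , ∉⇒Missing {c = c} γ∉ })
      (λ v xv → γ , here (cong (_, γ) (only v xv)))
      (λ { (here refl) (here refl) → refl })
      (λ { (here refl) (here refl) a≢a → ⊥-elim (a≢a refl) })
    where
      open Deleted xq ex
      only : ∀ v → adj g x v ≡ true → v ≡ q
      only v xv with same? v q
      ... | inj₁ e = e
      ... | inj₂ v≢q = ⊥-elim (count-zero (≤-pred (≰⇒> none)) v (∖-intro {p = adj g x} xv v≢q))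
  low-degree-reducible {x} {q} {c′} xq ex d2 big3 | yes some with count-∃ some
  ... | y , e with ∖-elim {p = adj g x} e
  ... | xy , y≢q with fresh-beyond (collect (c y)) (collect bigcols) (few xy)
           (≤-trans (length-collect bigcols λ w e → let b , e′ = restrict-just {p = big} {h = c q} e in
              ∧-intro (proj₂ (edge-adj e′)) b) big3)
    where
      open Deleted xq ex
      big : Fin n → Bool
      big w = does (5 ≤? degree g w)
      bigcols = restrict big (c q)
  ... | α , α∉y , α∉big = missing-at-q
    where
      open Deleted xq ex
      big : Fin n → Bool
      big w = does (5 ≤? degree g w)
      yα = ∉⇒Missing {c = c} α∉y

      only : ∀ v → adj g x v ≡ true → v ≢ q → v ≡ y
      only v xv v≢q with same? v y
      ... | inj₁ e = e
      ... | inj₂ v≢y = ⊥-elim (count-zero {p = adj g x ∖ q ∖ y}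
            (≤-pred (≤-pred (≤-trans (≤-reflexive (sym (trans (count-remove (adj g x) q xq)
              (cong suc (count-remove (adj g x ∖ q) y e))))) d2)))
            v (∖-intro {p = adj g x ∖ q} (∖-intro {p = adj g x} xv v≢q) v≢y))

      ¬extend : ∀ {γ} → Missing c q γ → α ≢ γ → ¬ Walk⁺ c γ α y q → ⊥
      ¬extend {γ} qγ α≢γ nw = ¬star ((y , α) ∷ (q , γ) ∷ [])
        (λ { (here refl) → xy , yα ; (there (here refl)) → xq , qγ })
        complete
        (λ { (here refl) (here refl) → refl ; (there (here refl)) (there (here refl)) → refl
           ; (here refl) (there (here refl)) → ⊥-elim (α≢γ refl)
           ; (there (here refl)) (here refl) → ⊥-elim (α≢γ refl) })
        (λ { (here refl) (here refl) a≢a → ⊥-elim (a≢a refl)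
           ; (there (here refl)) (there (here refl)) a≢a → ⊥-elim (a≢a refl)
           ; (here refl) (there (here refl)) _ → nw
           ; (there (here refl)) (here refl) _ → nw ∘ reverse⁺ valid })
        where
          complete : ∀ v → adj g x v ≡ true → ∃ λ a → (v , a) ∈ (y , α) ∷ (q , γ) ∷ []
          complete v xv with same? v q
          ... | inj₁ refl = γ , there (here refl)
          ... | inj₂ v≢q = α , here (cong (_, α) (only v xv v≢q))

      used-at-q : ∀ w → c q w ≡ just α → ⊥
      -- By the choice of α the degree of w is at most 4, so a γ missing at q can avoid the at most
      -- three colours on the other edges at w. A (γ , α)-walk into q would have to reach w by a
      -- γ-edge.
      used-at-q w e with fresh-beyond (collect (c q)) (others c w q) (few xq)
        (len-others (adj-sym (proj₂ (edge-adj e))) (≮⇒≥ λ 5≤ → α∉big (∈-collect (restrict big (c q)) w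
          (just-restrict {p = big} {h = c q} (dec-true (5 ≤? degree g w) 5≤) e))))
      ... | γ , γ∉q , γ∉w = ¬extend (∉⇒Missing {c = c} γ∉q) α≢γ λ walk →
              let w′ , s , p , r = first-edge (reverse⁺ valid walk) in seen (proper valid e p) r
        where
          α≢γ : α ≢ γ
          α≢γ refl = γ∉q (∈-collect (c q) w e)
          seen : ∀ {w′ s} → w ≡ w′ → c w′ s ≡ just γ → ⊥
          seen {s = s} refl r with same? s q
          ... | inj₁ refl = ∉⇒Missing {c = c} γ∉q w (flip valid r)
          ... | inj₂ s≢q = γ∉w (∈-others {c = c} s≢q r)

      missing-at-q : ⊥
      missing-at-q with fresh-beyond (collect (c q)) (α ∷ []) (few xq) (s≤s z≤n)
      ... | γ , γ∉q , γ∉ = ¬extend (∉⇒Missing {c = c} γ∉q) (proj₁ (∉-∷ γ∉)) (¬end valid used-at-q)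

  third : ∀ {x q} → adj g x q ≡ true → degree g x ≡ 3 → ∃ λ y → ∃ λ z →
    (adj g x y ≡ true × y ≢ q) × (adj g x z ≡ true × z ≢ q × y ≢ z) ×
    (∀ v → adj g x v ≡ true → v ≡ q ⊎ v ≡ y ⊎ v ≡ z)
  third {x} {q} xq d with degree-∖ xq d
  ... | d₁ with count-∃ (≤-trans (s≤s z≤n) (≤-reflexive (sym d₁)))
  ... | y , y∈ with suc-injective (trans (sym (count-remove (adj g x ∖ q) y y∈)) d₁)
  ... | d₂ with count-∃ (≤-reflexive (sym d₂))
  ... | z , z∈ with suc-injective (trans (sym (count-remove (adj g x ∖ q ∖ y) z z∈)) d₂)
                  | ∖-elim {p = adj g x} y∈ | ∖-elim {p = adj g x ∖ q} z∈
  ... | d₃ | xy , y≢q | z∈′ , z≢y with ∖-elim {p = adj g x} z∈′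
  ... | xz , z≢q = y , z , (xy , y≢q) , (xz , z≢q , z≢y ∘ sym) , only
    where
      only : ∀ v → adj g x v ≡ true → v ≡ q ⊎ v ≡ y ⊎ v ≡ z
      only v xv with same? v q | same? v y | same? v z
      ... | inj₁ e | _ | _ = inj₁ e
      ... | inj₂ _ | inj₁ e | _ = inj₂ (inj₁ e)
      ... | inj₂ _ | inj₂ _ | inj₁ e = inj₂ (inj₂ e)
      ... | inj₂ v≢q | inj₂ v≢y | inj₂ v≢z = ⊥-elim (count-zero (≤-reflexive d₃) v
        (∖-intro {p = adj g x ∖ q ∖ y} (∖-intro {p = adj g x ∖ q} (∖-intro {p = adj g x} xv v≢q) v≢y) v≢z))

  module Around {x q : Fin n} (xq : adj g x q ≡ true) (d3 : degree g x ≡ 3) where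

    triple : (y z : Fin n) (α β γ : Fin K) → List (Fin n × Fin K)
    triple y z α β γ = (y , α) ∷ (z , β) ∷ (q , γ) ∷ []

    record Neighbours (y z : Fin n) : Set where
      field
        xy : adj g x y ≡ true
        xz : adj g x z ≡ true
        y≢q : y ≢ q
        z≢q : z ≢ q
        y≢z : y ≢ z
        only : ∀ v → adj g x v ≡ true → v ≡ q ⊎ v ≡ y ⊎ v ≡ z

    swapN : ∀ {y z} → Neighbours y z → Neighbours z y
    swapN nb = record { xy = xz ; xz = xy ; y≢q = z≢q ; z≢q = y≢q ; y≢z = y≢z ∘ sym
                      ; only = λ v e → Sum.map₂ Sum.swap (only v e) }
      where open Neighbours nb

    module _ {y z} (nb : Neighbours y z) {α β γ : Fin K}
      (α≢β : α ≢ β) (α≢γ : α ≢ γ) (β≢γ : β ≢ γ) where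
      open Neighbours nb

      triple-complete : ∀ v → adj g x v ≡ true → ∃ λ a → (v , a) ∈ triple y z α β γ
      triple-complete v xv with only v xv
      ... | inj₁ refl = γ , there (there (here refl))
      ... | inj₂ (inj₁ refl) = α , here refl
      ... | inj₂ (inj₂ refl) = β , there (here refl)

      triple-sound : ∀ {c : Partial n K} → Missing c y α → Missing c z β → Missing c q γ →
        ∀ {v a} → (v , a) ∈ triple y z α β γ → adj g x v ≡ true × Missing c v a
      triple-sound yα zβ qγ (here refl) = xy , yα
      triple-sound yα zβ qγ (there (here refl)) = xz , zβ
      triple-sound yα zβ qγ (there (there (here refl))) = xq , qγ

      triple-injective : ∀ {u v a} → (u , a) ∈ triple y z α β γ → (v , a) ∈ triple y z α β γ → u ≡ v
      triple-injective (here refl) (here refl) = refl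
      triple-injective (here refl) (there (here refl)) = ⊥-elim (α≢β refl)
      triple-injective (here refl) (there (there (here refl))) = ⊥-elim (α≢γ refl)
      triple-injective (there (here refl)) (here refl) = ⊥-elim (α≢β refl)
      triple-injective (there (here refl)) (there (here refl)) = refl
      triple-injective (there (here refl)) (there (there (here refl))) = ⊥-elim (β≢γ refl)
      triple-injective (there (there (here refl))) (here refl) = ⊥-elim (α≢γ refl)
      triple-injective (there (there (here refl))) (there (here refl)) = ⊥-elim (β≢γ refl)
      triple-injective (there (there (here refl))) (there (there (here refl))) = refl

      triple-safe : ∀ {c : Partial n K} → Valid c →
        ¬ Walk⁺ c β α y z → ¬ Walk⁺ c γ α y q → ¬ Walk⁺ c γ β z q →
        ∀ {u v a b} → (u , a) ∈ triple y z α β γ → (v , b) ∈ triple y z α β γ → a ≢ b → ¬ Walk⁺ c b a u v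
      triple-safe vc yz yq zq (here refl) (here refl) ne = ⊥-elim (ne refl)
      triple-safe vc yz yq zq (here refl) (there (here refl)) ne = yz
      triple-safe vc yz yq zq (here refl) (there (there (here refl))) ne = yq
      triple-safe vc yz yq zq (there (here refl)) (here refl) ne = yz ∘ reverse⁺ vc
      triple-safe vc yz yq zq (there (here refl)) (there (here refl)) ne = ⊥-elim (ne refl)
      triple-safe vc yz yq zq (there (here refl)) (there (there (here refl))) ne = zq
      triple-safe vc yz yq zq (there (there (here refl))) (here refl) ne = yq ∘ reverse⁺ vc
      triple-safe vc yz yq zq (there (there (here refl))) (there (here refl)) ne = zq ∘ reverse⁺ vc
      triple-safe vc yz yq zq (there (there (here refl))) (there (there (here refl))) ne = ⊥-elim (ne refl)

    module _ {c′ : Partial n K} (ex : Except g x q c′) where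
      open Deleted xq ex

      -- The colouring `c′` supplies α and β as its colours of xy and xz; a blocking walk would
      -- close to a bichromatic cycle of `c′`.
      hole : ∃ λ y → ∃ λ z → Neighbours y z × ∃ λ α → ∃ λ β → Hole c q y z α β
      hole with third xq d3
      ... | y , z , (xy , y≢q) , (xz , z≢q , y≢z) , only
        with is-just-just (trans (Except.at ex y≢q) xy) | is-just-just (trans (Except.at ex z≢q) xz)
      ... | α , eα | β , eβ = y , z , nb , α , β , record
          { valid = valid ; y≢z = y≢z ; y≢q = y≢q ; z≢q = z≢q
          ; len-y = few xy ; len-z = few xz ; len-q = few xq
          ; miss-y = miss eα ; miss-z = miss eβ
          ; α≢β = λ { refl → y≢z (proper vc′ eα eβ) }
          ; free = λ w → acyc vc′ (λ { refl → y≢z (proper vc′ eα eβ) })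
              (shift eα (toWalk (Walk⁺-⊆ (proj₂ ∘ wipe-edge) w)) (flip vc′ eβ))
          ; ¬extend = λ {α} {β} {γ} yα zβ qγ α≢β α≢γ β≢γ yz yq zq → ¬star (triple y z α β γ)
              (triple-sound nb α≢β α≢γ β≢γ yα zβ qγ) (triple-complete nb α≢β α≢γ β≢γ)
              (triple-injective nb α≢β α≢γ β≢γ) (triple-safe nb α≢β α≢γ β≢γ valid yz yq zq) }
        where
          vc′ = Except.valid ex
          nb = record { xy = xy ; xz = xz ; y≢q = y≢q ; z≢q = z≢q ; y≢z = y≢z ; only = only }
          miss : ∀ {v a} → c′ x v ≡ just a → Missing c v a
          miss {v} e w e′ with wipe-edge {c = c′} e′
          ... | (_ , w≢x) , e″ = w≢x (proper vc′ e″ (flip vc′ e))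

  -- Without xq, q sees at most three colours, while y and z each miss at least four; so each of
  -- them misses some colour together with q.
  cubic-reducible : ∀ {x q c} → adj g x q ≡ true → Except g x q c → degree g x ≡ 3 → degree g q ≤ 4 → ⊥
  cubic-reducible {x} {q} xq ex d3 d4 with Around.hole xq d3 ex
  ... | y , z , _ , _ , _ , h = conflict few-at-q
    where
      open Deleted xq ex
      few-at-q : length (collect (c q)) ≤ 3
      few-at-q = ≤-trans (length-collect (c q) λ w e →
          let (_ , w≢x) , a = edge-adj e in ∖-intro {p = adj g q} a w≢x)
        (≤-pred (≤-trans (≤-reflexive (sym (count-remove (adj g q) x (adj-sym xq)))) d4))
      conflict : length (collect (c q)) ≤ 3 → ⊥
      conflict l with fresh-beyond (collect (c y)) (collect (c q)) (Hole.len-y h) l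
                  | fresh-beyond (collect (c z)) (collect (c q)) (Hole.len-z h) l
      ... | b , b∉y , b∉q | d , d∉z , d∉q = ¬missing-on-both-sides h (≤-trans l (n≤1+n 3))
        (∉⇒Missing {c = c} b∉y) (∉⇒Missing {c = c} b∉q) (∉⇒Missing {c = c} d∉z) (∉⇒Missing {c = c} d∉q)

-- Reducibility of a vertex of degree 5 with four cubic neighbours

module Quintic {n K} (g : Graph n) (room : ∀ v → degree g v + 3 ≤ K)
  (uncolourable : ∀ (c : Partial n K) → Valid c → Colours g c → ⊥)
  {q : Fin n} (d5 : degree g q ≡ 5) (t4 : 4 ≤ threes g q) where

  open Minimal g room uncolourable

  -- Two distinct non-cubic neighbours would leave room for only three cubic ones among five.
  non-cubic-unique : ∀ {v w} → adj g q v ≡ true → degree g v ≢ 3 → adj g q w ≡ true → degree g w ≢ 3 → v ≡ w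
  non-cubic-unique {v} {w} qv v≢3 qw w≢3 with same? v w
  ... | inj₁ e = e
  ... | inj₂ v≢w = ⊥-elim (<⇒≱ (s≤s ≤-refl) (≤-trans t4 (≤-trans
      (count-mono {p = λ u → adj g q u ∧ does (degree g u ≟ 3)} {q = adj g q ∖ v ∖ w} λ u e →
        let qu , t = ∧-elim {adj g q u} e ; u3 = witness (degree g u ≟ 3) t in
        ∖-intro {p = adj g q ∖ v} (∖-intro {p = adj g q} qu λ { refl → v≢3 u3 }) λ { refl → w≢3 u3 })
      (≤-reflexive (suc-injective (trans
        (sym (count-remove (adj g q ∖ v) w (∖-intro {p = adj g q} qw (v≢w ∘ sym)))) (degree-∖ qv d5)))))))

  -- The situation in which colouring x with (α , d , c q x₂) moves the hole from x to x₂.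
  record State {x : Fin n} (xq : adj g x q ≡ true) (d3 : degree g x ≡ 3) (c : Partial n K) : Set where
    field
      {y z} : Fin n
      nb : Around.Neighbours xq d3 y z
      {α d} : Fin K
      {w} : Fin n
      qw : c q w ≡ just α
      w≢3 : degree g w ≢ 3
      yα : Missing c y α
      zd : Missing c z d
      qd : Missing c q d
      free : ¬ Walk⁺ c d α y z
      forced : ∀ {γ} → Missing c q γ → γ ≢ d → ¬ ¬ Walk⁺ c γ α y q
      unseen : ∀ {v s} → c q v ≡ just s → Missing c y s

  module _ {x x₂ : Fin n} (xq : adj g x q ≡ true) (d3 : degree g x ≡ 3) {c′ : Partial n K}
    (ex : Except g x q c′) (x₂q : adj g x₂ q ≡ true) (d3₂ : degree g x₂ ≡ 3) (x₂≢x : x₂ ≢ x) where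
    open Deleted xq ex

    private
      N : Fin K → Set
      N = Missing c q

      ≤4-at-q : length (collect (c q)) ≤ 4
      ≤4-at-q = ≤-trans (length-collect (c q) λ w e →
          let (_ , w≢x) , a = edge-adj e in ∖-intro {p = adj g q} a w≢x)
        (≤-reflexive (degree-∖ (adj-sym xq) d5))

      len-others-q : ∀ {w s} → c q w ≡ just s → length (others c q w) ≤ 3
      len-others-q {w} e = ≤-trans (length-others {c = c} {p = adj g q ∖ x} λ e′ →
            let (_ , w′≢x) , a = edge-adj e′ in ∖-intro {p = adj g q} a w′≢x)
          (≤-reflexive (suc-injective (trans
            (sym (count-remove (adj g q ∖ x) w
              (let (_ , w≢x) , a = edge-adj e in ∖-intro {p = adj g q} a w≢x)))
            (degree-∖ (adj-sym xq) d5))))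

      -- Of the four or more colours missing at y, one avoids the at most three colours on the edges
      -- at q other than qw. Were it not s, it would be missing at q as well.
      unseen′ : ∀ {y z α β} → Hole c q y z α β → (∀ {γ} → N γ → Missing c y γ → ⊥) →
        ∀ {w s} → c q w ≡ just s → Missing c y s
      unseen′ {y} h Y∩N=∅ {w} {s} e with fresh-beyond (collect (c y)) (others c q w) (Hole.len-y h) (len-others-q e)
      ... | t , t∉y , t∉q with t ≟F s
      ... | yes refl = ∉⇒Missing {c = c} t∉y
      ... | no t≢s = ⊥-elim (Y∩N=∅ qt (∉⇒Missing {c = c} t∉y))
        where
          qt : N t
          qt w′ e′ with same? w′ w
          ... | inj₁ refl = t≢s (just-injective (trans (sym e′) e))
          ... | inj₂ w′≢w = t∉q (∈-others {c = c} w′≢w e′)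

      -- The walk ends with an α-edge into q, which by properness is wq; the edge before it has
      -- colour γ.
      enters : ∀ {w α γ y} → c q w ≡ just α → Walk⁺ c γ α y q → ∃ λ s → c w s ≡ just γ
      enters e walk with first-edge (reverse⁺ valid walk)
      ... | w′ , s , p , r with proper valid e p
      ... | refl = s , r

      -- w sees only two colours besides α, fewer than N and l leave to choose from.
      escape : ∀ {w α} (l : List (Fin K)) → length l ≤ 1 → c q w ≡ just α → degree g w ≡ 3 →
        ∃ λ γ → N γ × γ ∉ l × (∀ y → ¬ Walk⁺ c γ α y q)
      escape {w} {α} l l1 e w3 with fresh-beyond (collect (c q)) (l ++ others c w q) (few xq)
          (≤-trans (≤-reflexive (length-++ l)) (+-mono-≤ l1
            (len-others (adj-sym (proj₂ (edge-adj e))) (≤-reflexive w3))))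
      ... | γ , γ∉q , γ∉ = γ , ∉⇒Missing {c = c} γ∉q , γ∉ ∘ ∈-++⁺ˡ , λ y walk →
              let s , r = enters e walk in seen r
        where
          seen : ∀ {s} → c w s ≡ just γ → ⊥
          seen {s} r with same? s q
          ... | inj₁ refl = ∉⇒Missing {c = c} γ∉q w (flip valid r)
          ... | inj₂ s≢q = γ∉ (∈-++⁺ʳ l (∈-others {c = c} s≢q r))

      -- By `unseen′`, Y and Z both consist of the colours seen at q. Let s be the colour of `q x₂`,
      -- t another colour in Y and Z, and γ in N such that by `escape` no (γ , s)-walk ends at q.
      -- Then (s , t , γ) and (t , s , γ) would be blocked by (γ , t)-walks into q from z and from
      -- y, which cannot coexist.
      ¬both-saturated : ∀ {y z α β} → Hole c q y z α β →
        (∀ {γ} → N γ → Missing c y γ → ⊥) → (∀ {γ} → N γ → Missing c z γ → ⊥) → ⊥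
      ¬both-saturated {y} {z} {α₀} {β₀} h Y∩N=∅ Z∩N=∅ with adj-edge (adj-≢ xq ∘ sym) x₂≢x (adj-sym x₂q)
      ... | s , e = main
        where
          open Hole h hiding (valid)
          ys = unseen′ h Y∩N=∅ e
          zs = unseen′ (swap h) Z∩N=∅ e
          pair : ∀ {t} → Missing c y t → Missing c z t → s ≢ t → ⊥
          pair {t} yt zt s≢t with escape [] z≤n e d3₂
          ... | γ , qγ , _ , no-walk = ¬extend ys zt qγ s≢t s≢γ t≢γ (¬start yt) (no-walk y) λ w →
              ¬extend yt zs qγ (s≢t ∘ sym) t≢γ s≢γ (¬start ys) (λ w′ →
                y≢z (walk-end valid (reverse valid (toWalk w′)) (reverse valid (toWalk w))
                  (λ _ _ p _ → yt _ p) (λ _ _ p _ → zt _ p))) (no-walk z)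
            where
              s≢γ : s ≢ γ
              s≢γ refl = Y∩N=∅ qγ ys
              t≢γ : t ≢ γ
              t≢γ refl = Y∩N=∅ qγ yt
          both : ∀ {y z α β t} → Hole c q y z α β → (∀ {γ} → N γ → Missing c y γ → ⊥) →
            (∀ {γ} → N γ → Missing c z γ → ⊥) → Missing c y t → ¬ ¬ Missing c z t
          both h′ Ye Ze yt k = Ye (λ w p → k (unseen′ (swap h′) Ze p)) yt
          main : ⊥
          main with s ≟F α₀
          -- The second colour t is whichever of α₀ and β₀ differs from s.
          ... | no s≢α = both h Y∩N=∅ Z∩N=∅ miss-y λ zα → pair miss-y zα s≢α
          ... | yes refl = both (swap h) Z∩N=∅ Y∩N=∅ miss-z λ yβ → pair yβ miss-z α≢β

      -- As d lies in Z and N, Y and N are disjoint. For γ ≢ d in N, (α , d , γ) can be blocked only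
      -- between y and q, so q has an α-edge. Its end w is not cubic, as `escape` would then yield
      -- an unblocked γ.
      saturated-state : ∀ {y z α β} → Around.Neighbours xq d3 y z → Hole c q y z α β →
        ∀ {d} → Missing c z d → N d → ¬ ¬ State xq d3 c
      saturated-state {y} {z} {α} {β} nb h {d} zd qd k with fresh-beyond (collect (c q)) (d ∷ []) (few xq) (s≤s z≤n)
      ... | γ₀ , γ₀∉q , γ₀∉d = forced (∉⇒Missing {c = c} γ₀∉q) (proj₁ (∉-∷ γ₀∉d) ∘ sym) λ walk →
              let w , _ , qw , _ = first-edge (reverse⁺ valid walk) in
              k record { nb = nb ; qw = qw ; w≢3 = λ w3 → cubic-end qw w3 ; yα = miss-y ; zd = zd ; qd = qd
                       ; free = freed ; forced = forced ; unseen = unseen′ h Y∩N=∅ }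
        where
          open Hole h hiding (valid)
          Y∩N=∅ : ∀ {γ} → N γ → Missing c y γ → ⊥
          Y∩N=∅ qγ yγ = ¬missing-on-both-sides h ≤4-at-q yγ qγ zd qd
          α≢ : ∀ {γ} → N γ → α ≢ γ
          α≢ qγ refl = Y∩N=∅ qγ miss-y
          freed : ¬ Walk⁺ c d α y z
          -- If β ≢ d, a (d , α)-walk from y to z excludes one from y to q, and (α , β , d) extends
          -- the colouring.
          freed walk with β ≟F d
          ... | yes refl = free walk
          ... | no β≢d = ¬extend miss-y miss-z qd α≢β (α≢ qd) β≢d free
            (λ walk′ → z≢q (walk-end valid (toWalk walk) (toWalk walk′)
              (λ _ _ p _ → zd _ p) (λ _ _ p _ → qd _ p))) (¬start zd)
          forced : ∀ {γ} → N γ → γ ≢ d → ¬ ¬ Walk⁺ c γ α y q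
          forced qγ γ≢d nw = ¬extend miss-y zd qγ (α≢ qd) (α≢ qγ) (γ≢d ∘ sym) freed nw (¬end valid qd)
          cubic-end : ∀ {w} → c q w ≡ just α → degree g w ≡ 3 → ⊥
          cubic-end qw w3 with escape (d ∷ []) (s≤s z≤n) qw w3
          ... | γ , qγ , γ∉ , no-walk = forced qγ (proj₁ (∉-∷ γ∉) ∘ sym) (no-walk y)

    -- By `¬both-saturated` one of Y and Z meets N; the neighbour on that side takes the role of z.
    state : ¬ ¬ State xq d3 c
    state k with Around.hole xq d3 ex
    ... | y , z , nb , _ , _ , h = ¬both-saturated h
      (λ qγ yγ → saturated-state (Around.swapN xq d3 nb) (swap h) yγ qγ k)
      (λ qγ zγ → saturated-state nb h zγ qγ k)

  module _ {x x₂ : Fin n} (xq : adj g x q ≡ true) (d3 : degree g x ≡ 3) {c′ : Partial n K}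
    (ex : Except g x q c′) (x₂q : adj g x₂ q ≡ true) (d3₂ : degree g x₂ ≡ 3) (x₂≢x : x₂ ≢ x)
    (st : State xq d3 (Deleted.c xq ex)) where
    open Deleted xq ex
    open State st
    open Around xq d3
    open Neighbours nb

    private
      x≢q = adj-≢ xq
      x₂≢q = adj-≢ x₂q
      s-edge = adj-edge (x≢q ∘ sym) x₂≢x (adj-sym x₂q)
      s = proj₁ s-edge
      qs : c q x₂ ≡ just s
      qs = proj₂ s-edge

      cut : Fin n → Maybe (Fin K)
      cut v = if does (v ≟F q) then nothing else c x₂ v

      cut-edge : ∀ {v a} → cut v ≡ just a → v ≢ q × c x₂ v ≡ just a
      cut-edge {v} e with v ≟F q
      ... | no v≢q = v≢q , e

      c⁻ = star x₂ cut c

      c⁻⊆c : ∀ {u v a} → c⁻ u v ≡ just a → c u v ≡ just a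
      c⁻⊆c {u} {v} e with same? u x₂ | same? v x₂
      ... | inj₁ refl | _ = proj₂ (cut-edge (trans (sym (star-from x₂ cut c v)) e))
      ... | inj₂ _ | inj₁ refl = flip valid (proj₂ (cut-edge (trans (sym (star-to x₂ cut c u)) e)))
      ... | inj₂ u≢ | inj₂ v≢ = trans (sym (star-off x₂ cut c u≢ v≢)) e

      valid⁻ : Valid c⁻
      valid⁻ = Valid-⊆ valid (star-sym x₂ cut c (symm valid)) c⁻⊆c

      α≢d : α ≢ d
      α≢d refl = qd _ qw
      α≢s : α ≢ s
      -- The edges qw and `q x₂` differ, because `x₂` is cubic and w is not.
      α≢s e = w≢3 (subst (λ v → degree g v ≡ 3) (proper valid (subst (λ a → c q x₂ ≡ just a) (sym e) qs) qw) d3₂)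
      d≢s : d ≢ s
      d≢s refl = qd _ qs
      ys = unseen qs

      qs⁻ : Missing c⁻ q s
      qs⁻ v e with proper valid (c⁻⊆c e) qs
      ... | refl = proj₁ (cut-edge (trans (sym (star-to x₂ cut c q)) e)) refl

      -- The edge xq takes over the colour s of `q x₂`, which is uncoloured in `c⁻`. No cycle
      -- closes: `free` handles y and z, s is missing at y, and d is missing at q.
      l = triple y z α d s
      sound : ∀ {v a} → (v , a) ∈ l → adj g x v ≡ true × Missing c⁻ v a
      sound = triple-sound nb α≢d α≢s d≢s (λ v e → yα v (c⁻⊆c e)) (λ v e → zd v (c⁻⊆c e)) qs⁻
      complete = triple-complete nb α≢d α≢s d≢s

      c₂′ = star x (assoc l) c⁻

      valid₂ : Valid c₂′
      valid₂ = star-valid x (assoc l) c⁻ valid⁻ (assoc-loop l (proj₁ ∘ sound) complete)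
        (λ p q → triple-injective nb α≢d α≢s d≢s (assoc-∈ l p) (assoc-∈ l q))
        (λ p → proj₂ (sound (assoc-∈ l p)))
        (λ p q → triple-safe nb α≢d α≢s d≢s valid⁻ (free ∘ Walk⁺-⊆ c⁻⊆c)
          (¬start ys ∘ Walk⁺-⊆ c⁻⊆c) (¬end valid qd ∘ Walk⁺-⊆ c⁻⊆c) (assoc-∈ l p) (assoc-∈ l q))

      colours-x : ∀ v → is-just (c₂′ x v) ≡ adj g x v
      colours-x v = trans (cong is-just (star-from x (assoc l) c⁻ v)) (assoc-adj l (proj₁ ∘ sound) complete v)

      colours-x′ : ∀ u → is-just (c₂′ u x) ≡ adj g u x
      colours-x′ u = trans (cong is-just (symm valid₂ u x)) (trans (colours-x u) (Graph.sym g x u))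

      colours-c : ∀ {u v} → u ≢ x → v ≢ x → is-just (c u v) ≡ adj g u v
      colours-c u≢x v≢x = trans (cong is-just (star-off x _ c′ u≢x v≢x)) (Except.off ex u≢x v≢x)

      ex₂ : Except g x₂ q c₂′
      ex₂ = record { valid = valid₂ ; off = off₂ ; at = at₂ }
        where
          off₂ : ∀ {u v} → u ≢ x₂ → v ≢ x₂ → is-just (c₂′ u v) ≡ adj g u v
          off₂ {u} {v} u≢ v≢ with same? u x | same? v x
          ... | inj₁ refl | _ = colours-x v
          ... | inj₂ _ | inj₁ refl = colours-x′ u
          ... | inj₂ u≢x | inj₂ v≢x = trans (cong is-just (trans (star-off x (assoc l) c⁻ u≢x v≢x)
                (star-off x₂ cut c u≢ v≢))) (colours-c u≢x v≢x)
          at₂ : ∀ {v} → v ≢ q → is-just (c₂′ x₂ v) ≡ adj g x₂ v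
          at₂ {v} v≢q with same? v x
          ... | inj₁ refl = colours-x′ x₂
          ... | inj₂ v≢x = trans (cong is-just (trans (star-off x (assoc l) c⁻ x₂≢x v≢x)
                (trans (star-from x₂ cut c v) cut≡))) (colours-c x₂≢x v≢x)
            where
              cut≡ : cut v ≡ c x₂ v
              cut≡ rewrite dec-false (v ≟F q) v≢q = refl

      module D₂ = Deleted x₂q ex₂
      c₂ = D₂.c

      old : ∀ {u v} → u ≢ x → v ≢ x → u ≢ x₂ → v ≢ x₂ → c₂ u v ≡ c u v
      old u≢x v≢x u≢ v≢ = trans (star-off x₂ _ c₂′ u≢ v≢)
        (trans (star-off x (assoc l) c⁻ u≢x v≢x) (star-off x₂ cut c u≢ v≢))

      x-edge : ∀ {v a} → c₂ x v ≡ just a → (v , a) ∈ l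
      x-edge {v} e with wipe-edge {c = c₂′} e
      ... | _ , e′ = assoc-∈ l (trans (sym (star-from x (assoc l) c⁻ v)) e′)

      y≢x = adj-≢ xy ∘ sym
      y≢x₂ : y ≢ x₂
      y≢x₂ refl = ys q (flip valid qs)

      yx : c₂ y x ≡ just α
      yx = trans (star-off x₂ _ c₂′ y≢x₂ (x₂≢x ∘ sym)) (trans (star-to x (assoc l) c⁻ y) assoc-y)
        where
          assoc-y : assoc l y ≡ just α
          assoc-y rewrite dec-true (y ≟F y) refl = refl

      -- Walks of the old state survive if x₂ does not see both of their colours.
      keep : ∀ {γ u v} → u ≢ x₂ → v ≢ x₂ → (∀ {r t} → c x₂ r ≡ just γ → c x₂ t ≡ just α → ⊥) →
        Walk c γ α u v → Walk c₂ γ α u v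
      keep u≢ v≢ nb [] = []
      keep {γ} {u} {v} u≢ v≢ nb (step {w = r} {t} p p′ rest) =
          step (lift u≢ r≢ p) (lift r≢ (t≢ rest) p′) (keep (t≢ rest) v≢ nb rest)
        where
          lift : ∀ {r t a} → r ≢ x₂ → t ≢ x₂ → c r t ≡ just a → c₂ r t ≡ just a
          lift r≢ t≢ e with proj₁ (edge-adj e)
          ... | r≢x , t≢x = trans (old r≢x t≢x r≢ t≢) e
          r≢ : r ≢ x₂
          r≢ refl = nb (flip valid p) p′
          t≢ : Walk c γ α t v → t ≢ x₂
          t≢ [] = v≢
          t≢ (step p″ _ _) refl = nb p″ (flip valid p′)

      module _ (st₂ : State x₂q d3₂ c₂) where
        open State st₂ using () renaming
          (y to y₂; α to α₂; d to d₂; qw to qw₂; w≢3 to w₂≢3; yα to yα₂; forced to forced₂)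

        w≢x₂ : w ≢ x₂
        w≢x₂ refl = w≢3 d3₂

        c₂qw : c₂ q w ≡ just α
        c₂qw with proj₁ (edge-adj qw)
        ... | q≢x , w≢x = trans (old q≢x w≢x (x₂≢q ∘ sym) w≢x₂) qw

        -- Both states point to the unique non-cubic neighbour of q, and the colour of that edge has
        -- not changed.
        α₂≡α : α₂ ≡ α
        α₂≡α with non-cubic-unique (proj₂ (edge-adj qw)) w≢3 (proj₂ (D₂.edge-adj qw₂)) w₂≢3
        ... | refl = just-injective (trans (sym qw₂) c₂qw)

        -- Both states force a (γ , α)-walk into q, and the old one survives in `c₂`. Traced back
        -- from q both stop: at y, because its α-edge leads to x, where γ is absent, and at `y₂`,
        -- because α is missing there. So y would be `y₂`, although y sees α.
        finish : ∀ {γ} → γ ∉ collect (c q) → d ≢ γ → d₂ ≢ γ →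
          (∀ {r t} → c x₂ r ≡ just γ → c x₂ t ≡ just α → ⊥) → ⊥
        finish {γ} γ∉q d≢γ d₂≢γ nb′ = forced (∉⇒Missing {c = c} γ∉q) (d≢γ ∘ sym) λ walk →
            forced₂ q₂γ (d₂≢γ ∘ sym) λ walk₂ → apart (walk-end D₂.valid
              (reverse D₂.valid (keep y≢x₂ (x₂≢q ∘ sym) nb′ (toWalk walk)))
              (reverse D₂.valid (toWalk (subst (λ a → Walk⁺ c₂ γ a y₂ q) α₂≡α walk₂)))
              stop-y (λ r _ p _ → yα₂ r (trans p (cong just (sym α₂≡α)))))
          where
            s≢γ : s ≢ γ
            s≢γ refl = γ∉q (∈-collect (c q) x₂ qs)
            α≢γ : α ≢ γ
            α≢γ refl = γ∉q (∈-collect (c q) w qw)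
            q₂γ : Missing c₂ q γ
            q₂γ v e with same? v x | D₂.edge-adj e
            ... | inj₁ refl | _ with x-edge (flip D₂.valid e)
            ... | here refl = α≢γ refl
            ... | there (here refl) = d≢γ refl
            ... | there (there (here refl)) = s≢γ refl
            q₂γ v e | inj₂ v≢x | (q≢ , v≢) , _ =
              γ∉q (∈-collect (c q) v (trans (sym (old (x≢q ∘ sym) v≢x q≢ v≢)) e))
            stop-y : ∀ r t → c₂ y r ≡ just α → c₂ r t ≡ just γ → ⊥
            stop-y r t p p′ with proper D₂.valid p yx
            ... | refl with x-edge p′
            ... | here refl = α≢γ refl
            ... | there (here refl) = d≢γ refl
            ... | there (there (here refl)) = s≢γ refl
            apart : y ≡ y₂ → ⊥
            apart refl = yα₂ x (trans yx (cong just (sym α₂≡α)))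

        third-edge : Fin n → Fin n → Bool
        third-edge e v = not (does (v ≟F q)) ∧ not (does (v ≟F e))

        -- If `x₂` sees α, γ must be absent there. Besides q and e it has one further neighbour, so
        -- d, `d₂` and one more colour are to be avoided: three in all, as `fresh-beyond` permits.
        seen-at-x₂ : ∀ {e} → c x₂ e ≡ just α → ⊥
        seen-at-x₂ {e} x₂e with fresh-beyond (collect (c q)) (d ∷ d₂ ∷ rest) (few xq) (s≤s (s≤s rest≤1))
          where
            rest = collect (restrict (third-edge e) (c x₂))
            e≢q : e ≢ q
            e≢q refl = α≢s (just-injective (trans (sym x₂e) (flip valid qs)))
            rest≤1 : length rest ≤ 1
            rest≤1 = ≤-trans (length-collect (restrict (third-edge e) (c x₂)) λ v eq →
                let pv , eq′ = restrict-just {p = third-edge e} {h = c x₂} {w = v} eq ; a , b = ∧-elim pv in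
                ∧-intro (∧-intro (proj₂ (edge-adj eq′)) a) b)
              (≤-reflexive (suc-injective (trans (sym (count-remove (adj g x₂ ∖ q) e
                (∖-intro {p = adj g x₂} (proj₂ (edge-adj x₂e)) e≢q))) (degree-∖ x₂q d3₂))))
        ... | γ , γ∉q , γ∉ with ∉-∷ γ∉
        ... | d≢γ , γ∉′ with ∉-∷ γ∉′
        ... | d₂≢γ , γ∉″ = finish γ∉q d≢γ d₂≢γ λ {r} x₂r _ → γ∉″ (∈-collect (restrict (third-edge e) (c x₂)) r
            (just-restrict {p = third-edge e} {h = c x₂} {w = r} (∧-intro (cong not (dec-false (r ≟F q) λ { refl →
                γ∉q (∈-collect (c q) x₂ (flip valid x₂r)) }))
              (cong not (dec-false (r ≟F e) λ { refl →
                γ∉q (∈-collect (c q) w (trans qw (trans (sym x₂e) x₂r))) }))) x₂r))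

        contradiction : ⊥
        contradiction with fresh-beyond (collect (c q)) (d ∷ d₂ ∷ []) (few xq) (s≤s (s≤s z≤n))
        ... | γ , γ∉q , γ∉ with ∉-∷ γ∉
        ... | d≢γ , γ∉′ = finish γ∉q d≢γ (proj₁ (∉-∷ γ∉′)) λ _ x₂t → seen-at-x₂ x₂t

    -- For some γ the (γ , α)-walks into q from y and from y₂ coincide, so y = y₂; but α is missing at y₂
    -- while yx now has colour α.
    two-holes : ⊥
    two-holes = state x₂q d3₂ ex₂ xq d3 (x₂≢x ∘ sym) contradiction

  private
    cubic : Fin n → Bool
    cubic w = adj g q w ∧ does (degree g w ≟ 3)

  quintic-reducible : (∀ x → adj g x q ≡ true → ¬ ¬ ∃ (Except {K = K} g x q)) → ⊥
  quintic-reducible colour with count-∃ {p = cubic} (≤-trans (s≤s z≤n) t4)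
  ... | x , e with count-∃ {p = cubic ∖ x} (≤-trans (s≤s z≤n)
        (≤-pred (≤-trans t4 (≤-reflexive (count-remove cubic x e)))))
  ... | x₂ , e₂ with ∖-elim {p = cubic} e₂
  ... | e₂′ , x₂≢x with ∧-elim {adj g q x} e | ∧-elim {adj g q x₂} e₂′
  ... | qx , t | qx₂ , t₂ = colour x (adj-sym qx) λ { (c , ex) →
      state (adj-sym qx) x3 ex (adj-sym qx₂) x₂3 x₂≢x
        (two-holes (adj-sym qx) x3 ex (adj-sym qx₂) x₂3 x₂≢x) }
    where
      x3 = witness (degree g x ≟ 3) t
      x₂3 = witness (degree g x₂ ≟ 3) t₂

-- Deleting an edge, and the induction

module _ {n} (g : Graph n) (x q : Fin n) where

  private
    xq? : Fin n → Fin n → Bool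
    xq? u v = (does (u ≟F x) ∧ does (v ≟F q)) ∨ (does (u ≟F q) ∧ does (v ≟F x))

  delete : Graph n
  delete = record
    { adj = λ u v → adj g u v ∧ not (xq? u v)
    ; sym = λ u v → cong₂ (λ a b → a ∧ not b) (Graph.sym g u v)
        (trans (∨-comm (does (u ≟F x) ∧ does (v ≟F q)) _)
          (cong₂ _∨_ (∧-comm (does (u ≟F q)) _) (∧-comm (does (u ≟F x)) _)))
    ; irrefl = λ v → cong (_∧ not (xq? v v)) (irrefl g v) }

  delete-⊆ : ∀ u v → adj delete u v ≡ true → adj g u v ≡ true
  delete-⊆ u v e = proj₁ (∧-elim e)

  delete-off : ∀ {u v} → u ≢ x → v ≢ x → adj delete u v ≡ adj g u v
  delete-off {u} {v} u≢x v≢x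
    rewrite dec-false (u ≟F x) u≢x | dec-false (v ≟F x) v≢x | ∧-zeroʳ (does (u ≟F q)) = ∧-identityʳ _

  delete-at : ∀ {v} → x ≢ q → v ≢ q → adj delete x v ≡ adj g x v
  delete-at {v} x≢q v≢q
    rewrite dec-false (v ≟F q) v≢q | dec-false (x ≟F q) x≢q | ∧-zeroʳ (does (x ≟F x)) = ∧-identityʳ _

  delete-degree : ∀ v → degree delete v ≤ degree g v
  delete-degree v = count-mono (delete-⊆ v)

  delete-< : adj g x q ≡ true → sumF (degree delete) < sumF (degree g)
  delete-< xq = sumF-mono-< delete-degree x (≤-trans (s≤s (count-mono {q = adj g x ∖ q} λ v e →
      ∖-intro {p = adj g x} (delete-⊆ x v e) λ { refl → clash (trans (sym (gone (adj g x q))) e) }))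
    (≤-reflexive (sym (count-remove (adj g x) q xq))))
    where
      gone : ∀ b → b ∧ not (xq? x q) ≡ false
      gone b rewrite dec-true (x ≟F x) refl | dec-true (q ≟F q) refl = ∧-zeroʳ b

  delete-PropertyA : PropertyA g → PropertyA delete
  delete-PropertyA pa S ne = ≤-trans (+-monoˡ-≤ 1 (sumF-mono λ u → count-mono λ v e →
      let su , e₁ = ∧-elim {S u} e ; sv , e₂ = ∧-elim {S v} e₁ ; a , lt = ∧-elim {adj delete u v} e₂ in
      ∧-intro su (∧-intro sv (∧-intro (delete-⊆ u v a) lt)))) (pa S ne)

-- Strong induction on the degree sum, with K fixed while degrees drop. If g were uncolourable,
-- every `delete g x q` would still be colourable, so no configuration occurs and g has no edge; but
-- then the empty colouring is one of g.
colourable : ∀ {n K} (g : Graph n) → Acc _<_ (sumF (degree g)) → PropertyA g → (∀ v → degree g v + 3 ≤ K) →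
  ¬ ¬ ∃ λ (c : Partial n K) → Valid c × Colours g c
colourable {n} {K} g (acc smaller) pa room uncolourable = uncolourable (c₀ , valid₀ , λ u v → sym (none u v))
  where
    un : ∀ (c : Partial n K) → Valid c → Colours g c → ⊥
    un c vc cc = uncolourable (c , vc , cc)
    open Minimal g room un

    colour : ∀ x q → adj g x q ≡ true → ¬ ¬ ∃ (Except {K = K} g x q)
    colour x q xq k = colourable (delete g x q) (smaller (delete-< g x q xq)) (delete-PropertyA g x q pa)
      (λ v → ≤-trans (+-monoˡ-≤ 3 (delete-degree g x q v)) (room v))
      λ { (c , vc , cc) → k (c , record
        { valid = vc
        ; off = λ u≢x v≢x → trans (cc _ _) (delete-off g x q u≢x v≢x)
        ; at = λ v≢q → trans (cc _ _) (delete-at g x q (adj-≢ xq) v≢q) }) }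

    edgeless : ∀ u v → adj g u v ≡ true → ⊥
    edgeless = no-reducible⇒edgeless g pa
      (λ x q xq d → ≮⇒≥ λ few → colour x q xq λ { (c , ex) → low-degree-reducible xq ex d (≤-pred few) })
      (λ x q xq d → ≮⇒≥ λ small → colour x q xq λ { (c , ex) → cubic-reducible xq ex d (≤-pred small) })
      (λ q d5 → ≮⇒≥ λ many → Quintic.quintic-reducible g room un d5 many λ x → colour x q)

    none : ∀ u v → adj g u v ≡ false
    none u v with adj g u v in e
    ... | false = refl
    ... | true = ⊥-elim (edgeless u v e)

    c₀ : Partial n K
    c₀ _ _ = nothing
    valid₀ : Valid c₀
    valid₀ = record { symm = λ _ _ → refl ; loop = λ _ → refl ; proper = λ () ; acyc = λ { _ (step () _ _) } }

-- Exhaustive search and translation to acyclic edge colourings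

Searchable : Set → Set₁
Searchable A = ∀ {P : A → Set} → Decidable P → Dec (∃ P)

search-Vec : ∀ {A m} → Searchable A → Searchable (Vec A m)
search-Vec {m = zero} s P? = map′ (λ p → [] , p) (λ { ([] , p) → p }) (P? [])
search-Vec {m = suc m} s P? = map′ (λ { (a , v , p) → a ∷ v , p }) (λ { (a ∷ v , p) → a , v , p })
  (s λ a → search-Vec s λ v → P? (a ∷ v))

module _ {n k : ℕ} (G : Graph n) where

  InAB : Fin k → Fin k → Fin k → Set
  InAB a b x = x ≡ a ⊎ x ≡ b

  record Bad (col : Fin n → Fin n → Fin k) (j : ℕ) (f : Fin (suc j) → Fin n) (ab : Fin k × Fin k) : Set where
    constructor bad
    field
      long : 2 ≤ j
      injective : ∀ i i′ → f i ≡ f i′ → i ≡ i′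
      steps : ∀ (i : Fin j) → T (adj G (f (inject₁ i)) (f (suc i))) ×
        InAB (proj₁ ab) (proj₂ ab) (col (f (inject₁ i)) (f (suc i)))
      closing : T (adj G (f (fromℕ j)) (f zero)) × InAB (proj₁ ab) (proj₂ ab) (col (f (fromℕ j)) (f zero))

  Bad-cong : ∀ {col j f f′ ab} → (∀ i → f i ≡ f′ i) → Bad col j f ab → Bad col j f′ ab
  Bad-cong {col} {ab = a , b} h (bad l i s c) = bad l
    (λ x y e → i x y (trans (h x) (trans e (sym (h y)))))
    (λ x → subst₂ E (h (inject₁ x)) (h (suc x)) (s x)) (subst₂ E (h _) (h zero) c)
    where
      E : Fin n → Fin n → Set
      E u v = T (adj G u v) × InAB a b (col u v)

  -- Vectors in place of functions: they can be enumerated up to propositional equality without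
  -- function extensionality.
  Matrix : Set
  Matrix = Vec (Vec (Fin k) n) n

  entry : Matrix → Fin n → Fin n → Fin k
  entry M u v = lookup (lookup M u) v

  -- The bound j < n makes the search for cycles finite; it costs nothing, since the j + 1 vertices
  -- of a cycle are distinct.
  record Good (M : Matrix) : Set where
    constructor good
    field
      symmetric : ∀ u v → T (adj G u v) → entry M u v ≡ entry M v u
      properly : ∀ u v w → T (adj G u v) → T (adj G u w) → entry M u v ≡ entry M u w → v ≡ w
      no-bad : ¬ ∃ λ j → j < n × ∃ λ (f : Vec (Fin n) (suc j)) → ∃ λ a → ∃ λ b → Bad (entry M) j (lookup f) (a , b)

  good? : Decidable Good
  good? M = map′ (λ { (s , p , b) → good s p b }) (λ { (good s p b) → s , p , b })
    (all? (λ u → all? λ v → T? (adj G u v) →-dec (entry M u v ≟F entry M v u))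
    ×-dec all? (λ u → all? λ v → all? λ w →
      T? (adj G u v) →-dec (T? (adj G u w) →-dec ((entry M u v ≟F entry M u w) →-dec (v ≟F w))))
    ×-dec ¬? (anyUpTo? (λ j → search-Vec any? λ f → any? λ a → any? λ b → bad? j (lookup f) a b) n))
    where
      inAB? : ∀ a b x → Dec (InAB a b x)
      inAB? a b x = (x ≟F a) ⊎-dec (x ≟F b)
      bad? : ∀ j f a b → Dec (Bad (entry M) j f (a , b))
      bad? j f a b = map′ (λ { (l , i , s , c) → bad l i s c }) (λ { (bad l i s c) → l , i , s , c })
        ((2 ≤? j)
        ×-dec all? (λ i → all? λ i′ → (f i ≟F f i′) →-dec (i ≟F i′))
        ×-dec all? (λ i → T? (adj G (f (inject₁ i)) (f (suc i))) ×-dec inAB? a b (entry M (f (inject₁ i)) (f (suc i))))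
        ×-dec (T? (adj G (f (fromℕ j)) (f zero)) ×-dec inAB? a b (entry M (f (fromℕ j)) (f zero))))

  good⇒acyclic : ∀ {M} → Good M → HasAcyclicEdgeColouring G k
  good⇒acyclic {M} (good s p nb) = record { col = entry M ; colSym = s } ,
    (λ u v w uv uw v≢w e → v≢w (p u v w uv uw e)) ,
    λ { C (a , b , st , cl) → nb (j C , injective⇒≤ (inj C) , tabulate (vert C) , a , b ,
        Bad-cong (λ i → sym (lookup∘tabulate (vert C) i)) (bad (len≥3 C) (λ _ _ → inj C)
          (λ i → Cycle.step C i , st i) (close C , cl))) }

  module _ {c : Partial n k} (vc : Valid c) where

    -- Two consecutive edges of equal colour would by properness identify two vertices of the path.
    -- So the colours alternate, and the two outcomes are even and odd length.
    alternate : ∀ j (f : Fin (suc (suc j)) → Fin n) → (∀ i i′ → f i ≡ f i′ → i ≡ i′) → ∀ {a b} →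
      (∀ i → c (f (inject₁ i)) (f (suc i)) ≡ just a ⊎ c (f (inject₁ i)) (f (suc i)) ≡ just b) →
      c (f zero) (f (suc zero)) ≡ just a →
      Walk⁺ c a b (f zero) (f (fromℕ (suc j))) ⊎
      ∃ λ s → Walk c a b (f zero) s × c s (f (fromℕ (suc j))) ≡ just a
    alternate zero f inj s e = inj₂ (_ , [] , e)
    alternate (suc j) f inj s e with s (suc zero)
    ... | inj₁ e₁ with inj _ _ (proper vc (flip vc e) e₁)
    ... | ()
    alternate (suc j) f inj s e | inj₂ e₁
      with alternate j (f ∘ suc) (λ i i′ eq → suc-inj (inj _ _ eq)) (λ i → Sum.swap (s (suc i))) e₁
      where
        suc-inj : ∀ {m} {i i′ : Fin m} → Fin.suc i ≡ suc i′ → i ≡ i′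
        suc-inj refl = refl
    ... | inj₁ w = inj₂ (unshift e (toWalk w))
    ... | inj₂ (t , w , e₂) = inj₁ (shift e w e₂)

    -- The closing edge cannot share the colour a of the first edge at `f zero`, so it has colour b.
    -- An even path then gives a closed walk of odd length, and an odd path a closed alternating
    -- walk.
    ¬bichromatic : ∀ j (f : Fin (suc (suc (suc j))) → Fin n) → (∀ i i′ → f i ≡ f i′ → i ≡ i′) → ∀ {a b} →
      (∀ i → c (f (inject₁ i)) (f (suc i)) ≡ just a ⊎ c (f (inject₁ i)) (f (suc i)) ≡ just b) →
      c (f zero) (f (suc zero)) ≡ just a →
      c (f (fromℕ (suc (suc j)))) (f zero) ≡ just a ⊎ c (f (fromℕ (suc (suc j)))) (f zero) ≡ just b → ⊥
    ¬bichromatic j f inj s e (inj₁ cl) with inj _ _ (proper vc (flip vc cl) e)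
    ... | ()
    ¬bichromatic j f inj s e (inj₂ cl) with alternate (suc j) f inj s e
    ... | inj₁ w = ¬odd-closed vc cl (toWalk w)
    ... | inj₂ (t , w , e₁) = acyc vc a≢b (snoc⁺ w e₁ cl)
      where
        a≢b : _ ≢ _
        a≢b refl with inj _ _ (proper vc (flip vc cl) e)
        ... | ()

  valid⇒good : Fin k → ∀ {c : Partial n k} → Valid c → Colours G c → ∃ Good
  valid⇒good default {c} vc cc = M , good
      (λ u v uv → just-injective (trans (sym (coloured uv)) (trans (symm vc u v) (coloured (T-sym u v uv)))))
      (λ u v w uv uw e → proper vc (coloured uv) (trans (coloured uw) (cong just (sym e))))
      ¬bad
    where
      M : Matrix
      -- `default` fills the entries of non-edges, which `Good` does not constrain.
      M = tabulate λ u → tabulate λ v → fromMaybe default (c u v)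
      entry-M : ∀ u v → entry M u v ≡ fromMaybe default (c u v)
      entry-M u v = trans (cong (λ r → lookup r v) (lookup∘tabulate _ u)) (lookup∘tabulate _ v)
      T-sym : ∀ u v → T (adj G u v) → T (adj G v u)
      T-sym u v = subst T (Graph.sym G u v)
      coloured : ∀ {u v} → T (adj G u v) → c u v ≡ just (entry M u v)
      coloured {u} {v} uv with is-just-just (trans (cc u v) (Equivalence.to T-≡ uv))
      ... | a , e = trans e (cong just (sym (trans (entry-M u v) (cong (fromMaybe default) e))))
      side : ∀ {u v a b} → T (adj G u v) × InAB a b (entry M u v) → c u v ≡ just a ⊎ c u v ≡ just b
      side (uv , e) = Sum.map (λ p → trans (coloured uv) (cong just p)) (λ p → trans (coloured uv) (cong just p)) e
      ¬bad : ¬ ∃ λ j → j < n × ∃ λ (f : Vec (Fin n) (suc j)) → ∃ λ a → ∃ λ b → Bad (entry M) j (lookup f) (a , b)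
      ¬bad (suc (suc j) , _ , f , a , b , bad l i s cl) with side (s zero)
      ... | inj₁ e = ¬bichromatic vc j (lookup f) i (side ∘ s) e (side cl)
      ... | inj₂ e = ¬bichromatic vc j (lookup f) i (Sum.swap ∘ side ∘ s) e (Sum.swap (side cl))
      ¬bad (suc zero , _ , _ , _ , _ , bad (s≤s ()) _ _ _)
      ¬bad (zero , _ , _ , _ , _ , bad () _ _ _)

≤-maxF : ∀ {n} (f : Fin n → ℕ) i → f i ≤ maxF f
≤-maxF f zero = m≤m⊔n (f zero) _
≤-maxF f (suc i) = ≤-trans (≤-maxF (f ∘ suc) i) (m≤n⊔m (f zero) _)

theorem1 : ∀ {n} (G : Graph n) → PropertyA G →
    HasAcyclicEdgeColouring G (maxDegree G + 3)
-- `Good` is decidable and matrices are searchable, which removes the double negation of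
-- `colourable`. The default colour exists because Δ + 3 is positive.
theorem1 G propA = good⇒acyclic G (proj₂ (decidable-stable (search-Vec (search-Vec any?) (good? G))
  λ none → colourable G (<-wellFounded _) propA (λ v → +-monoˡ-≤ 3 (≤-maxF (degree G) v))
    λ { (c , vc , cc) → none (valid⇒good G (fromℕ< (≤-trans (s≤s z≤n) (m≤n+m 3 (maxDegree G)))) vc cc) }))
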